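{- Let $p$ be a prime with $p\equiv 5$ or $7 \pmod{8}$, and let $l$ be an integer with $0\leq l\leq p-1$ such that $p$ divides $8l+3$. Then for all integers $n\geq 0$, \[a_{p-4}(pn+l)\equiv 0\pmod{p}.\]
   Context: For a positive integer $c$, a generalized cubic partition of $n$ is a partition of $n$ whose even parts may appear in $c$ different colors; $a_c(n)$ denotes the number of such partitions of $n$, with $a_c(0)=1$. Equivalently, writing $f_m=\prod_{k\geq 1}(1-q^{mk})$ for $|q|<1$, \[\sum_{n=0}^\infty a_c(n)q^n=\frac{1}{f_1 f_2^{\,c-1}}.\] -}

module Defs where

open import Data.Nat using (ℕ; zero; suc; _+_; _*_; _∸_; _%_; _≤ᵇ_; _≡ᵇ_)
open import Data.Bool using (if_then_else_)
open import Data.List using (List; []; _∷_; map; upTo; concatMap; replicate)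
open import Data.Nat.ListAction using (sum)

-- Number of partitions of n using parts from the list of "part kinds" ks,
-- where each entry of ks is the size of a distinct kind of part (two
-- entries with equal size are different colours of that size).
-- Each kind k is used with some multiplicity j (0 ≤ j ≤ n), contributing j*k.
countParts : ℕ → List ℕ → ℕ
countParts n [] = if n ≡ᵇ 0 then 1 else 0
countParts n (k ∷ ks) =
  sum (map (λ j → if j * k ≤ᵇ n then countParts (n ∸ j * k) ks else 0) (upTo (suc n)))

colouredKinds : ℕ → ℕ → List ℕ
colouredKinds c n = concatMap (λ i → kinds (suc i)) (upTo n)
  where
  kinds : ℕ → List ℕ
  kinds k = if k % 2 ≡ᵇ 0 then replicate c k else k ∷ []

-- a_c(n): number of generalized cubic partitions of n
-- (partitions of n whose even parts may appear in c different colours).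
a : ℕ → ℕ → ℕ
a c n = countParts n (colouredKinds c n)

{-# OPTIONS --safe #-}

-- Write f₁ = ∏ (1 - q^i), f₂ = ∏ (1 - q^(2i)) and c = p - 4, so that the
-- generating function G of a_c satisfies G f₁ f₂^(p-5) = 1.  By Gauss,
-- f₁ ψ = f₂² with ψ = ∑ q^(j(j+1)/2), and by Jacobi,
-- f₂³ = J = ∑ (-1)^k (2k+1) q^(k(k+1)), hence G f₂^p = ψ J.  A term of ψ J has
-- exponent N with 8N + 3 = (2j+1)² + 2(2k+1)²; if p divides 8N + 3 then p
-- divides 2k+1, because -2 is a nonresidue, so the term vanishes mod p.  Since
-- f₂^p is mod p a product of factors 1 - q^(2ip), dividing by it does not
-- disturb this vanishing.
--
-- Series are taken modulo q^M, where q is nilpotent; then f₁ and f₂ are finite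
-- products, and Gauss and Jacobi are the cases z = -1 and z = 1 of a finite form
-- of the triple product, valid in any commutative ring.

module Submission where

open import Algebra.Bundles using (CommutativeRing)
import Algebra.Properties.AbelianGroup as AbelianGroupProperties
import Algebra.Properties.CommutativeSemigroup as CommutativeSemigroupProperties
import Algebra.Properties.CommutativeSemiring.Binomial as Binomial
import Algebra.Properties.CommutativeSemiring.Exp as Exp
import Algebra.Properties.Group as GroupProperties
import Algebra.Properties.Ring as RingProperties
import Algebra.Properties.Semiring.Mult as Mult
import Algebra.Properties.Semiring.Mult.TCOptimised as Mult′
import Algebra.Properties.Semiring.Sum as Sum
import Algebra.Solver.Ring as RingSolver
open import Algebra.Solver.Ring.AlmostCommutativeRing using (fromCommutativeRing; _-Raw-AlmostCommutative⟶_)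
open import Data.Bool using (true; false; if_then_else_)
open import Data.Fin as Fin using (Fin; toℕ)
import Data.Fin.Properties as Fin
open import Data.Integer as ℤ using (ℤ; -[1+_])
import Data.Integer.Properties as ℤ
open import Data.List using (List; []; _∷_; _++_; upTo; applyUpTo; concatMap; replicate)
import Data.List.Properties as List
open import Data.List.Relation.Unary.All using (All; []; _∷_)
import Data.List.Relation.Unary.All.Properties as All
open import Data.Maybe using (Maybe; map)
open import Data.Nat as ℕ using (ℕ; zero; suc; _≤_; _<_; _≤ᵇ_; _≡ᵇ_; _∸_; _%_; _!; z≤n; s≤s; NonZero)
open import Data.Nat.Combinatorics using (_C_; nCk≡n!/k![n-k]!; nCn≡1; k![n∸k]!∣n!)
open import Data.Nat.Coprimality using (Coprime; coprime-Bézout)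
open import Data.Nat.Divisibility
open import Data.Nat.DivMod
open import Data.Nat.GCD using (module Bézout)
open import Data.Nat.Induction using (<-rec)
open import Data.Nat.Primality using (Prime; euclidsLemma; prime⇒nonTrivial; prime⇒irreducible)
import Data.Nat.Properties as ℕ
open import Data.Nat.Tactic.RingSolver using (solve-∀)
open import Data.Product using (∃-syntax; _,_)
import Data.Sign as Sign
open import Data.Sum using (_⊎_; inj₁; inj₂)
open import Function using (_∘_)
open import Level using (0ℓ; _⊔_)
import Relation.Binary.Construct.On as On
open import Relation.Binary.PropositionalEquality as ≡ using (_≡_; _≢_)
import Relation.Binary.Reasoning.Setoid as SetoidReasoning
open import Relation.Nullary using (¬_; yes; no; contradiction)
open import Relation.Nullary.Decidable using (dec⇒maybe; dec-true; dec-false)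

-- Jacobi's identity usually comes from the triple product by dividing by 1 - z and letting z tend
-- to 1. Neither step makes sense in a general ring, so the terms k and -k-1 of the bilateral sum
-- are paired and the factor 1 - z⁻¹ is removed beforehand. What is left depends on z only through t
-- = z + z⁻¹, and t = 2 and t = -2 can be substituted directly.
--
-- Division by f₂^p takes no inverse series either. The series that vanish at every index n with p
-- dividing 8n + 3 form an additive group stable under multiplication by q^p, and in such a group a
-- factor 1 - z can be cancelled whenever z is a nilpotent power of q^p. The argument is carried out
-- for an abstract group of this kind.
--
-- That -2 is a nonresidue is not drawn from the supplementary laws of reciprocity: a descent on the
-- modulus shows that -2 is not a square modulo any n that is 5 or 7 mod 8, prime or not.

-- Tools for arbitrary commutative rings: a solver with integer coefficients, powers and multiples.

module IntegerCoefficients {c ℓ} (R : CommutativeRing c ℓ) where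
  open CommutativeRing R
  open import Data.Integer using (+_)
  -- For this variant of `_×_`, `1 × 1#` is `1#` by definition, so the solver constants `:0` and
  -- `:1` denote `0#` and `1#` on the nose.
  open Mult′ semiring
  open RingProperties ring using (-‿distribˡ-*; -‿distribʳ-*; -0#≈0#)
  open AbelianGroupProperties +-abelianGroup using (⁻¹-∙-comm; ⁻¹-involutive)
  open SetoidReasoning setoid

  ⟦_⟧ℤ : ℤ → Carrier
  ⟦ + n ⟧ℤ = n × 1#
  ⟦ -[1+ n ] ⟧ℤ = - (suc n × 1#)

  private
    sub-cancelˡ : ∀ a b c → b - c ≈ (a + b) - (a + c)
    sub-cancelˡ a b c = sym (begin
      (a + b) + - (a + c)   ≈⟨ +-cong (+-comm a b) (sym (⁻¹-∙-comm a c)) ⟩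
      (b + a) + (- a + - c) ≈⟨ +-assoc b a _ ⟩
      b + (a + (- a + - c)) ≈⟨ +-congˡ (sym (+-assoc a (- a) (- c))) ⟩
      b + ((a + - a) + - c) ≈⟨ +-congˡ (+-congʳ (-‿inverseʳ a)) ⟩
      b + (0# + - c)        ≈⟨ +-congˡ (+-identityˡ _) ⟩
      b - c                 ∎)

    ⟦⊖⟧ : ∀ m n → ⟦ m ℤ.⊖ n ⟧ℤ ≈ m × 1# - n × 1#
    ⟦⊖⟧ zero zero = sym (-‿inverseʳ 0#)
    ⟦⊖⟧ zero (suc n) = sym (+-identityˡ _)
    ⟦⊖⟧ (suc m) zero = sym (trans (+-congˡ -0#≈0#) (+-identityʳ _))
    ⟦⊖⟧ (suc m) (suc n) = begin
      ⟦ suc m ℤ.⊖ suc n ⟧ℤ                ≡⟨ ≡.cong ⟦_⟧ℤ (ℤ.[1+m]⊖[1+n]≡m⊖n m n) ⟩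
      ⟦ m ℤ.⊖ n ⟧ℤ                        ≈⟨ ⟦⊖⟧ m n ⟩
      m × 1# - n × 1#                     ≈⟨ sub-cancelˡ 1# _ _ ⟩
      (1# + m × 1#) - (1# + n × 1#)       ≈⟨ +-cong (1+× m 1#) (-‿cong (1+× n 1#)) ⟨
      suc m × 1# - suc n × 1#             ∎

    ⟦-◃⟧ : ∀ n → ⟦ Sign.- ℤ.◃ n ⟧ℤ ≈ - (n × 1#)
    ⟦-◃⟧ zero = sym -0#≈0#
    ⟦-◃⟧ (suc n) = refl

    +-homo : ∀ i j → ⟦ i ℤ.+ j ⟧ℤ ≈ ⟦ i ⟧ℤ + ⟦ j ⟧ℤ
    +-homo (+ m) (+ n) = ×-homo-+ 1# m n
    +-homo (+ m) -[1+ n ] = ⟦⊖⟧ m (suc n)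
    +-homo -[1+ m ] (+ n) = trans (⟦⊖⟧ n (suc m)) (+-comm _ _)
    +-homo -[1+ m ] -[1+ n ] = begin
      - (suc (suc (m ℕ.+ n)) × 1#)          ≡⟨ ≡.cong (λ k → - (suc k × 1#)) (≡.sym (ℕ.+-suc m n)) ⟩
      - ((suc m ℕ.+ suc n) × 1#)            ≈⟨ -‿cong (×-homo-+ 1# (suc m) (suc n)) ⟩
      - (suc m × 1# + suc n × 1#)           ≈⟨ ⁻¹-∙-comm _ _ ⟨
      - (suc m × 1#) + - (suc n × 1#)       ∎

    *-homo : ∀ i j → ⟦ i ℤ.* j ⟧ℤ ≈ ⟦ i ⟧ℤ * ⟦ j ⟧ℤ
    *-homo (+ m) (+ n) = begin
      ⟦ Sign.+ ℤ.◃ (m ℕ.* n) ⟧ℤ ≡⟨ ≡.cong ⟦_⟧ℤ (ℤ.+◃n≡+n (m ℕ.* n)) ⟩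
      (m ℕ.* n) × 1#            ≈⟨ ×1-homo-* m n ⟩
      (m × 1#) * (n × 1#)       ∎
    *-homo (+ m) -[1+ n ] = begin
      ⟦ Sign.- ℤ.◃ (m ℕ.* suc n) ⟧ℤ  ≈⟨ ⟦-◃⟧ (m ℕ.* suc n) ⟩
      - ((m ℕ.* suc n) × 1#)         ≈⟨ -‿cong (×1-homo-* m (suc n)) ⟩
      - ((m × 1#) * (suc n × 1#))    ≈⟨ -‿distribʳ-* _ _ ⟩
      (m × 1#) * - (suc n × 1#)      ∎
    *-homo -[1+ m ] (+ n) = begin
      ⟦ Sign.- ℤ.◃ (suc m ℕ.* n) ⟧ℤ  ≈⟨ ⟦-◃⟧ (suc m ℕ.* n) ⟩
      - ((suc m ℕ.* n) × 1#)         ≈⟨ -‿cong (×1-homo-* (suc m) n) ⟩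
      - ((suc m × 1#) * (n × 1#))    ≈⟨ -‿distribˡ-* _ _ ⟩
      - (suc m × 1#) * (n × 1#)      ∎
    *-homo -[1+ m ] -[1+ n ] = begin
      (suc m ℕ.* suc n) × 1#                ≈⟨ ×1-homo-* (suc m) (suc n) ⟩
      (suc m × 1#) * (suc n × 1#)           ≈⟨ ⁻¹-involutive _ ⟨
      - - ((suc m × 1#) * (suc n × 1#))     ≈⟨ -‿cong (-‿distribˡ-* _ _) ⟩
      - (- (suc m × 1#) * (suc n × 1#))     ≈⟨ -‿distribʳ-* _ _ ⟩
      - (suc m × 1#) * - (suc n × 1#)       ∎

    -‿homo : ∀ i → ⟦ ℤ.- i ⟧ℤ ≈ - ⟦ i ⟧ℤ
    -‿homo (+ zero) = sym -0#≈0#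
    -‿homo (+ suc n) = refl
    -‿homo -[1+ n ] = sym (⁻¹-involutive _)

    ℤ-homomorphism : ℤ.+-*-rawRing -Raw-AlmostCommutative⟶ fromCommutativeRing R
    ℤ-homomorphism = record
      { ⟦_⟧ = ⟦_⟧ℤ
      ; +-homo = +-homo
      ; *-homo = *-homo
      ; -‿homo = -‿homo
      ; 0-homo = refl
      ; 1-homo = refl
      }

    ≟-coeff : ∀ i j → Maybe (⟦ i ⟧ℤ ≈ ⟦ j ⟧ℤ)
    ≟-coeff i j = map (λ i≡j → reflexive (≡.cong ⟦_⟧ℤ i≡j)) (dec⇒maybe (i ℤ.≟ j))

  private module Solver = RingSolver ℤ.+-*-rawRing (fromCommutativeRing R) ℤ-homomorphism ≟-coeff
  open Solver public
    using (solve; _:+_; _:*_; _:-_; :-_; _:=_)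

  :0 :1 : ∀ {n} → Solver.Polynomial n
  :0 = Solver.con (+ 0)
  :1 = Solver.con (+ 1)

module PowersAndMultiples {c ℓ} (R : CommutativeRing c ℓ) where
  open CommutativeRing R hiding (zero)
  open Exp commutativeSemiring
  open Mult semiring

  1^n≈1 : ∀ n → 1# ^ n ≈ 1#
  1^n≈1 zero = refl
  1^n≈1 (suc n) = trans (*-identityˡ _) (1^n≈1 n)

  n×0≈0 : ∀ n → n × 0# ≈ 0#
  n×0≈0 zero = refl
  n×0≈0 (suc n) = trans (+-identityˡ _) (n×0≈0 n)

  CharacteristicDivides : ℕ → Set ℓ
  CharacteristicDivides p = p × 1# ≈ 0#

-- The finite form of the triple product.

triangle : ℕ → ℕ
triangle zero = 0
triangle (suc k) = suc k ℕ.+ triangle k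

k≤triangle : ∀ k → k ≤ triangle k
k≤triangle zero = z≤n
k≤triangle (suc k) = ℕ.m≤m+n (suc k) (triangle k)

module FiniteTripleProduct {c ℓ} (R : CommutativeRing c ℓ) where
  open CommutativeRing R hiding (zero)
  open IntegerCoefficients R
  open Exp commutativeSemiring
  open SetoidReasoning setoid

  ∑< ∏≤ : ℕ → (ℕ → Carrier) → Carrier
  ∑< zero f = 0#
  ∑< (suc n) f = ∑< n f + f n
  ∏≤ zero f = 1#
  ∏≤ (suc n) f = ∏≤ n f * f (suc n)

  ∑-cong : ∀ n {f g} → (∀ k → k < n → f k ≈ g k) → ∑< n f ≈ ∑< n g
  ∑-cong zero f≈g = refl
  ∑-cong (suc n) f≈g = +-cong (∑-cong n (λ k k<n → f≈g k (ℕ.m<n⇒m<1+n k<n))) (f≈g n ℕ.≤-refl)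

  *-distribˡ-∑ : ∀ n a f → a * ∑< n f ≈ ∑< n (λ k → a * f k)
  *-distribˡ-∑ zero a f = zeroʳ a
  *-distribˡ-∑ (suc n) a f = trans (distribˡ a _ _) (+-congʳ (*-distribˡ-∑ n a f))

  ∏-cong : ∀ n {f g} → (∀ k → f (suc k) ≈ g (suc k)) → ∏≤ n f ≈ ∏≤ n g
  ∏-cong zero f≈g = refl
  ∏-cong (suc n) f≈g = *-cong (∏-cong n f≈g) (f≈g n)

  ∏-* : ∀ n f g → ∏≤ n f * ∏≤ n g ≈ ∏≤ n (λ k → f k * g k)
  ∏-* zero f g = *-identityˡ 1#
  ∏-* (suc n) f g = trans
    (solve 4 (λ a b c d → (a :* b) :* (c :* d) := (a :* c) :* (b :* d)) refl _ _ _ _)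
    (*-congʳ (∏-* n f g))

  -- The q-Pochhammer symbol (x; x)_n.
  poch : Carrier → ℕ → Carrier
  poch x n = ∏≤ n (λ i → 1# - x ^ i)

  module _ (x : Carrier) where

    private
      P : ℕ → Carrier
      P = poch x

    -- d n k is x ^ triangle k times the Gaussian binomial
    -- coefficient [2n+1 choose n-k]; the recurrence is the two-step Pascal rule.
    d : ℕ → ℕ → Carrier
    d zero zero = 1#
    d zero (suc k) = 0#
    d (suc n) zero = (1# + x ^ suc n + x ^ suc n * x ^ suc n) * d n 0 + x ^ suc n * d n 1
    d (suc n) (suc k) = (1# + x ^ suc n * x ^ suc n) * d n (suc k)
                      + x ^ suc n * (d n k + d n (suc (suc k)))

    d-zero : ∀ n k → n < k → d n k ≈ 0#
    d-zero zero (suc k) n<k = refl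
    d-zero (suc n) (suc k) (s≤s n<k) = begin
      (1# + q * q) * d n (suc k) + q * (d n k + d n (suc (suc k)))
        ≈⟨ +-cong (*-congˡ (d-zero n (suc k) (ℕ.m<n⇒m<1+n n<k)))
                  (*-congˡ (+-cong (d-zero n k n<k) (d-zero n (suc (suc k)) (ℕ.m<n⇒m<1+n (ℕ.m<n⇒m<1+n n<k))))) ⟩
      (1# + q * q) * 0# + q * (0# + 0#)
        ≈⟨ solve 1 (λ q → (:1 :+ q :* q) :* :0 :+ q :* (:0 :+ :0) := :0) refl q ⟩
      0# ∎
      where q = x ^ suc n

    -- With t = z + z⁻¹ the recurrence forces c k = (-1)^k (z^(-k) + … + z^k), and
    -- the factor 1 - t q + q² below is (1 - z q)(1 - z⁻¹ q).
    module _ (t : Carrier) (c : ℕ → Carrier) (c₀ : c 0 ≈ 1#) (c₁ : c 1 ≈ - (t + 1#))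
             (c₊ : ∀ k → c (suc (suc k)) ≈ - (t * c (suc k)) - c k) where

      private
        factor : ℕ → Carrier
        factor i = 1# - t * x ^ i + x ^ i * x ^ i

        -- Summation by parts. Expanding `factor` uses -t c(k) = c(k+1) + c(k-1), and at k = 0 it
        -- uses -t c(0) = c(1) + c(0), whence the extra term in the row k = 0 of `d`. Cutting the
        -- sum at L leaves the last summand as a boundary term.
        ∑-step : ∀ n L →
          ∑< (suc L) (λ k → c k * d (suc n) k) ≈
          factor (suc n) * ∑< (suc L) (λ k → c k * d n k)
          + x ^ suc n * (c L * d n (suc L) - c (suc L) * d n L)
        ∑-step n zero = begin
          0# + c 0 * ((1# + q + q * q) * d n 0 + q * d n 1)
            ≈⟨ +-congˡ (*-congʳ c₀) ⟩
          0# + 1# * ((1# + q + q * q) * d n 0 + q * d n 1)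
            ≈⟨ solve 4 (λ t q d0 d1 →
                 :0 :+ :1 :* ((:1 :+ q :+ q :* q) :* d0 :+ q :* d1)
                 := (:1 :- t :* q :+ q :* q) :* (:0 :+ :1 :* d0)
                    :+ q :* (:1 :* d1 :- (:- (t :+ :1)) :* d0)) refl t q (d n 0) (d n 1) ⟩
          factor (suc n) * (0# + 1# * d n 0) + q * (1# * d n 1 - - (t + 1#) * d n 0)
            ≈⟨ +-cong (*-congˡ (+-congˡ (*-congʳ c₀)))
                      (*-congˡ (+-cong (*-congʳ c₀) (-‿cong (*-congʳ c₁)))) ⟨
          factor (suc n) * (0# + c 0 * d n 0) + q * (c 0 * d n 1 - c 1 * d n 0) ∎
          where q = x ^ suc n
        ∑-step n (suc L) = begin
          ∑< (suc L) (λ k → c k * d (suc n) k)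
            + c (suc L) * ((1# + q * q) * d n (suc L) + q * (d n L + d n (suc (suc L))))
            ≈⟨ +-congʳ (∑-step n L) ⟩
          (factor (suc n) * S + q * (c L * d n (suc L) - c (suc L) * d n L))
            + c (suc L) * ((1# + q * q) * d n (suc L) + q * (d n L + d n (suc (suc L))))
            ≈⟨ solve 8 (λ t q s c0 c1 d0 d1 d2 →
                 ((:1 :- t :* q :+ q :* q) :* s :+ q :* (c0 :* d1 :- c1 :* d0))
                   :+ c1 :* ((:1 :+ q :* q) :* d1 :+ q :* (d0 :+ d2))
                 := (:1 :- t :* q :+ q :* q) :* (s :+ c1 :* d1)
                    :+ q :* (c1 :* d2 :- ((:- (t :* c1)) :- c0) :* d1))
                 refl t q S (c L) (c (suc L)) (d n L) (d n (suc L)) (d n (suc (suc L))) ⟩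
          factor (suc n) * (S + c (suc L) * d n (suc L))
            + q * (c (suc L) * d n (suc (suc L)) - (- (t * c (suc L)) - c L) * d n (suc L))
            ≈⟨ +-congˡ (*-congˡ (+-congˡ (-‿cong (*-congʳ (c₊ L))))) ⟨
          factor (suc n) * (S + c (suc L) * d n (suc L))
            + q * (c (suc L) * d n (suc (suc L)) - c (suc (suc L)) * d n (suc L)) ∎
          where q = x ^ suc n
                S = ∑< (suc L) (λ k → c k * d n k)

      -- The cut-off L is independent of n so that one L serves the whole induction; the boundary
      -- term of `∑-step` then vanishes by `d-zero`.
      finite-triple-product : ∀ n L → n ≤ L →
        ∑< (suc L) (λ k → c k * d n k) ≈ ∏≤ n factor
      finite-triple-product zero L n≤L = go L
        where
        go : ∀ L → ∑< (suc L) (λ k → c k * d 0 k) ≈ 1#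
        go zero = trans (+-identityˡ _) (trans (*-identityʳ _) c₀)
        go (suc L) = trans (+-cong (go L) (zeroʳ _)) (+-identityʳ 1#)
      finite-triple-product (suc n) L n<L = begin
        ∑< (suc L) (λ k → c k * d (suc n) k)
          ≈⟨ ∑-step n L ⟩
        factor (suc n) * S + q * (c L * d n (suc L) - c (suc L) * d n L)
          ≈⟨ +-congˡ (*-congˡ (+-cong (*-congˡ (d-zero n (suc L) (ℕ.m<n⇒m<1+n n<L)))
                                      (-‿cong (*-congˡ (d-zero n L n<L))))) ⟩
        factor (suc n) * S + q * (c L * 0# - c (suc L) * 0#)
          ≈⟨ solve 5 (λ f s q a b → f :* s :+ q :* (a :* :0 :- b :* :0) := s :* f)
               refl (factor (suc n)) S q (c L) (c (suc L)) ⟩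
        S * factor (suc n)
          ≈⟨ *-congʳ (finite-triple-product n L (ℕ.<⇒≤ n<L)) ⟩
        ∏≤ n factor * factor (suc n) ∎
        where q = x ^ suc n
              S = ∑< (suc L) (λ k → c k * d n k)

    -- The closed form at k + 1 would involve `P (m - 1)`. Multiplying by 1 - x^m restores `P m` and
    -- also covers m = 0, where both sides are zero. The closed form for row n is an argument, so
    -- that `d-closed` remains a structural recursion on n.
    d-closed↑ : ∀ n m k → m ℕ.+ k ≡ n →
      (∀ m k → m ℕ.+ k ≡ n → P m * P (suc (n ℕ.+ k)) * d n k ≈ P (suc (n ℕ.+ n)) * x ^ triangle k) →
      P m * P (suc (suc (n ℕ.+ k))) * d n (suc k) ≈ (1# - x ^ m) * (P (suc (n ℕ.+ n)) * x ^ triangle (suc k))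
    d-closed↑ n zero .n ≡.refl ih = begin
      P 0 * P (suc (suc (n ℕ.+ n))) * d n (suc n)
        ≈⟨ *-congˡ (d-zero n (suc n) ℕ.≤-refl) ⟩
      P 0 * P (suc (suc (n ℕ.+ n))) * 0#
        ≈⟨ solve 2 (λ a b → a :* :0 := (:1 :- :1) :* b) refl _ _ ⟩
      (1# - 1#) * (P (suc (n ℕ.+ n)) * x ^ triangle (suc n)) ∎
    d-closed↑ n (suc m) k eq ih = begin
      P m * (1# - x ^ suc m) * P (suc (suc (n ℕ.+ k))) * d n (suc k)
        ≈⟨ solve 4 (λ a b c d → a :* b :* c :* d := b :* (a :* c :* d)) refl _ _ _ _ ⟩
      (1# - x ^ suc m) * (P m * P (suc (suc (n ℕ.+ k))) * d n (suc k))
        ≡⟨ ≡.cong (λ j → (1# - x ^ suc m) * (P m * P (suc j) * d n (suc k))) (≡.sym (ℕ.+-suc n k)) ⟩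
      (1# - x ^ suc m) * (P m * P (suc (n ℕ.+ suc k)) * d n (suc k))
        ≈⟨ *-congˡ (ih m (suc k) (≡.trans (ℕ.+-suc m k) eq)) ⟩
      (1# - x ^ suc m) * (P (suc (n ℕ.+ n)) * x ^ triangle (suc k)) ∎

    -- The quotient formula for the Gaussian binomial with denominators cleared, as 1 - x^i need not
    -- be invertible here.
    d-closed : ∀ n m k → m ℕ.+ k ≡ n →
      P m * P (suc (n ℕ.+ k)) * d n k ≈ P (suc (n ℕ.+ n)) * x ^ triangle k
    d-closed zero zero zero eq = *-congʳ (*-identityˡ _)
    d-closed (suc n) m zero eq
      rewrite ≡.trans (≡.sym (ℕ.+-identityʳ m)) eq | ℕ.+-identityʳ n | ℕ.+-suc n n = begin
      P n * (1# - x * a) * (P n * (1# - x * a) * (1# - x * (x * a)))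
        * ((1# + x * a + x * a * (x * a)) * d n 0 + x * a * d n 1)
        ≈⟨ solve 7 (λ a x p w w′ d0 d1 →
             p :* w :* (p :* w :* w′) :* ((:1 :+ x :* a :+ x :* a :* (x :* a)) :* d0 :+ x :* a :* d1)
             := w :* w′ :* (:1 :+ x :* a :+ x :* a :* (x :* a)) :* (p :* (p :* w) :* d0)
                :+ w :* (x :* a) :* (p :* (p :* w :* w′) :* d1))
             refl a x (P n) (1# - x * a) (1# - x * (x * a)) (d n 0) (d n 1) ⟩
      (1# - x * a) * (1# - x * (x * a)) * (1# + x * a + x * a * (x * a)) * (P n * P (suc n) * d n 0)
        + (1# - x * a) * (x * a) * (P n * P (suc (suc n)) * d n 1)
        ≈⟨ +-cong (*-congˡ h₀) (*-congˡ h₁) ⟩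
      (1# - x * a) * (1# - x * (x * a)) * (1# + x * a + x * a * (x * a)) * (N * 1#)
        + (1# - x * a) * (x * a) * ((1# - a) * (N * (x * 1#)))
        ≈⟨ solve 3 (λ a x N →
             (:1 :- x :* a) :* (:1 :- x :* (x :* a)) :* (:1 :+ x :* a :+ x :* a :* (x :* a)) :* (N :* :1)
               :+ (:1 :- x :* a) :* (x :* a) :* ((:1 :- a) :* (N :* (x :* :1)))
             := N :* (:1 :- x :* (x :* (a :* a))) :* (:1 :- x :* (x :* (x :* (a :* a)))) :* :1)
             refl a x N ⟩
      N * (1# - x * (x * (a * a))) * (1# - x * (x * (x * (a * a)))) * 1#
        ≈⟨ *-congʳ (*-cong (*-congˡ (+-congˡ (-‿cong (*-congˡ (*-congˡ a²)))))
                           (+-congˡ (-‿cong (*-congˡ (*-congˡ (*-congˡ a²)))))) ⟨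
      N * (1# - x * (x * x ^ (n ℕ.+ n))) * (1# - x * (x * (x * x ^ (n ℕ.+ n)))) * 1# ∎
      where
      a = x ^ n
      N = P (suc (n ℕ.+ n))
      a² = ^-homo-* x n n
      h₀ : P n * P (suc n) * d n 0 ≈ N * 1#
      h₀ = ≡.subst (λ j → P n * P (suc j) * d n 0 ≈ N * 1#) (ℕ.+-identityʳ n)
             (d-closed n n 0 (ℕ.+-identityʳ n))
      h₁ : P n * P (suc (suc n)) * d n 1 ≈ (1# - a) * (N * (x * 1#))
      h₁ = ≡.subst (λ j → P n * P (suc (suc j)) * d n 1 ≈ (1# - a) * (N * (x * 1#))) (ℕ.+-identityʳ n)
             (d-closed↑ n n 0 (ℕ.+-identityʳ n) (d-closed n))
    d-closed (suc n) zero (suc .n) ≡.refl rewrite ℕ.+-suc n n = begin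
      1# * (N * w * w′) * ((1# + x * a * (x * a)) * d n (suc n) + x * a * (d n n + d n (suc (suc n))))
        ≈⟨ *-congˡ (+-cong (*-congˡ (d-zero n (suc n) ℕ.≤-refl))
                           (*-congˡ (+-congˡ (d-zero n (suc (suc n)) (ℕ.n≤1+n (suc n)))))) ⟩
      1# * (N * w * w′) * ((1# + x * a * (x * a)) * 0# + x * a * (d n n + 0#))
        ≈⟨ solve 6 (λ N w w′ a x d →
             :1 :* (N :* w :* w′) :* ((:1 :+ x :* a :* (x :* a)) :* :0 :+ x :* a :* (d :+ :0))
             := w :* w′ :* (x :* a) :* (:1 :* N :* d)) refl N w w′ a x (d n n) ⟩
      w * w′ * (x * a) * (1# * N * d n n)
        ≈⟨ *-congˡ (d-closed n zero n ≡.refl) ⟩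
      w * w′ * (x * a) * (N * x ^ triangle n)
        ≈⟨ solve 6 (λ N w w′ a x y →
             w :* w′ :* (x :* a) :* (N :* y) := N :* w :* w′ :* (x :* (a :* y)))
             refl N w w′ a x (x ^ triangle n) ⟩
      N * w * w′ * (x * (a * x ^ triangle n))
        ≈⟨ *-congˡ (*-congˡ (^-homo-* x n (triangle n))) ⟨
      N * w * w′ * x ^ (suc (n ℕ.+ triangle n)) ∎
      where
      a = x ^ n
      N = P (suc (n ℕ.+ n))
      w = 1# - x ^ suc (suc (n ℕ.+ n))
      w′ = 1# - x ^ suc (suc (suc (n ℕ.+ n)))
    d-closed (suc n) (suc m) (suc k) eq rewrite ℕ.+-suc n n | ℕ.+-suc n k = begin
      P m * (1# - x * a) * (S * (1# - x * s) * (1# - x * (x * s)))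
        * ((1# + x * e * (x * e)) * d n (suc k) + x * e * (d n k + d n (suc (suc k))))
        ≈⟨ *-congʳ (*-congˡ (*-cong (*-congˡ (+-congˡ (-‿cong (*-congˡ s≈)))) (+-congˡ (-‿cong (*-congˡ (*-congˡ s≈)))))) ⟩
      P m * (1# - x * a) * (S * w₁ * w₂)
        * ((1# + x * e * (x * e)) * d n (suc k) + x * e * (d n k + d n (suc (suc k))))
        ≈⟨ *-congˡ (+-cong (*-congʳ (+-congˡ (*-cong (*-congˡ e≈) (*-congˡ e≈)))) (*-congʳ (*-congˡ e≈))) ⟩
      P m * (1# - x * a) * (S * w₁ * w₂)
        * ((1# + q * q) * d n (suc k) + q * (d n k + d n (suc (suc k))))
        ≈⟨ solve 9 (λ p w s w₁ w₂ q d₀ d₁ d₂ →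
             p :* w :* (s :* w₁ :* w₂) :* ((:1 :+ q :* q) :* d₁ :+ q :* (d₀ :+ d₂))
             := w :* w₂ :* (:1 :+ q :* q) :* (p :* (s :* w₁) :* d₁)
                :+ (q :* w₁ :* w₂ :* (p :* w :* s :* d₀) :+ q :* w :* (p :* (s :* w₁ :* w₂) :* d₂)))
             refl (P m) (1# - x * a) S w₁ w₂ q (d n k) (d n (suc k)) (d n (suc (suc k))) ⟩
      (1# - x * a) * w₂ * (1# + q * q) * (P m * (S * w₁) * d n (suc k))
        + (q * w₁ * w₂ * (P m * (1# - x * a) * S * d n k)
           + q * (1# - x * a) * (P m * (S * w₁ * w₂) * d n (suc (suc k))))
        ≈⟨ +-cong (*-congˡ h₁) (+-cong (*-congˡ h₀) (*-congˡ h₂)) ⟩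
      (1# - x * a) * w₂ * (1# + q * q) * (N * (x * (b * y)))
        + (q * w₁ * w₂ * (N * y)
           + q * (1# - x * a) * ((1# - a) * (N * (x * (x * (b * (x * (b * y))))))))
        -- As n = m + k + 1, every power of x in the recurrence has become a monomial in x, a = x^m,
        -- b = x^k and y, and a polynomial identity remains.
        ≈⟨ solve 5 (λ a b x N y →
             (:1 :- x :* a) :* (:1 :- x :* (x :* (x :* (x :* (a :* b) :* b)))) :* (:1 :+ x :* (x :* (a :* b)) :* (x :* (x :* (a :* b)))) :* (N :* (x :* (b :* y)))
               :+ (x :* (x :* (a :* b)) :* (:1 :- x :* (x :* (x :* (a :* b) :* b))) :* (:1 :- x :* (x :* (x :* (x :* (a :* b) :* b)))) :* (N :* y)
                   :+ x :* (x :* (a :* b)) :* (:1 :- x :* a) :* ((:1 :- a) :* (N :* (x :* (x :* (b :* (x :* (b :* y))))))))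
             := N :* (:1 :- x :* (x :* (x :* (a :* b) :* (x :* (a :* b))))) :* (:1 :- x :* (x :* (x :* (x :* (a :* b) :* (x :* (a :* b)))))) :* (x :* (b :* y)))
             refl a b x N y ⟩
      N * (1# - x * (x * (x * (a * b) * (x * (a * b))))) * (1# - x * (x * (x * (x * (a * b) * (x * (a * b)))))) * (x * (b * y))
        ≈⟨ *-cong (*-cong (*-congˡ (+-congˡ (-‿cong (*-congˡ (*-congˡ e²)))))
                          (+-congˡ (-‿cong (*-congˡ (*-congˡ (*-congˡ e²))))))
                  (*-congˡ (^-homo-* x k (triangle k))) ⟨
      N * (1# - x ^ suc (suc (n ℕ.+ n))) * (1# - x ^ suc (suc (suc (n ℕ.+ n)))) * x ^ triangle (suc k) ∎
      where
      a = x ^ m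
      b = x ^ k
      y = x ^ triangle k
      e = x ^ n
      s = x ^ suc (n ℕ.+ k)
      q = x * (x * (a * b))
      S = P (suc (n ℕ.+ k))
      N = P (suc (n ℕ.+ n))
      w₁ = 1# - x * (x * (x * (a * b) * b))
      w₂ = 1# - x * (x * (x * (x * (a * b) * b)))
      m+k : suc (m ℕ.+ k) ≡ n
      m+k = ≡.trans (≡.sym (ℕ.+-suc m k)) (ℕ.suc-injective eq)
      e≈ : e ≈ x * (a * b)
      e≈ = trans (reflexive (≡.cong (x ^_) (≡.sym m+k))) (*-congˡ (^-homo-* x m k))
      s≈ : s ≈ x * (x * (a * b) * b)
      s≈ = *-congˡ (trans (^-homo-* x n k) (*-congʳ e≈))
      e² : x ^ (n ℕ.+ n) ≈ x * (a * b) * (x * (a * b))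
      e² = trans (^-homo-* x n n) (*-cong e≈ e≈)
      y₁ : x ^ triangle (suc k) ≈ x * (b * y)
      y₁ = *-congˡ (^-homo-* x k (triangle k))
      y₂ : x ^ triangle (suc (suc k)) ≈ x * (x * (b * (x * (b * y))))
      y₂ = *-congˡ (*-congˡ (trans (^-homo-* x k _) (*-congˡ y₁)))
      P₁ : P (suc (suc (n ℕ.+ k))) ≈ S * w₁
      P₁ = *-congˡ (+-congˡ (-‿cong (*-congˡ s≈)))
      P₂ : P (suc (suc (suc (n ℕ.+ k)))) ≈ S * w₁ * w₂
      P₂ = *-cong P₁ (+-congˡ (-‿cong (*-congˡ (*-congˡ s≈))))
      h₀ : P m * (1# - x * a) * S * d n k ≈ N * y
      h₀ = d-closed n (suc m) k m+k
      h₁ : P m * (S * w₁) * d n (suc k) ≈ N * (x * (b * y))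
      h₁ = trans (*-congʳ (*-congˡ (sym P₁)))
             (trans (≡.subst (λ j → P m * P (suc j) * d n (suc k) ≈ N * x ^ triangle (suc k)) (ℕ.+-suc n k)
                      (d-closed n m (suc k) (ℕ.suc-injective eq)))
                    (*-congˡ y₁))
      h₂ : P m * (S * w₁ * w₂) * d n (suc (suc k)) ≈ (1# - a) * (N * (x * (x * (b * (x * (b * y))))))
      h₂ = trans (*-congʳ (*-congˡ (sym P₂)))
             (trans (≡.subst (λ j → P m * P (suc (suc j)) * d n (suc (suc k)) ≈ (1# - a) * (N * x ^ triangle (suc (suc k)))) (ℕ.+-suc n k)
                      (d-closed↑ n m (suc k) (ℕ.suc-injective eq) (d-closed n)))
                    (*-congˡ (*-congˡ y₂)))

-- The Frobenius map in characteristic p.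

prime∤! : ∀ {p} → Prime p → ∀ k → k < p → ¬ (p ∣ k !)
prime∤! pr zero k<p p∣1 = ℕ.nonTrivial⇒≢1 {{prime⇒nonTrivial pr}} (∣1⇒≡1 p∣1)
prime∤! pr (suc k) k<p p∣k! with euclidsLemma (suc k) (k !) pr p∣k!
... | inj₁ p∣1+k = ℕ.<⇒≱ k<p (∣⇒≤ p∣1+k)
... | inj₂ p∣k!′ = prime∤! pr k (ℕ.<⇒≤ k<p) p∣k!′

prime∣C : ∀ {p} → Prime p → ∀ k → 0 < k → k < p → p ∣ p C k
prime∣C {p@(suc p-1)} pr k@(suc k-1) 0<k k<p
  with euclidsLemma (p C k) (k ! ℕ.* (p ℕ.∸ k) !) pr p∣product
  where
  instance _ = k ℕ.!* (p ℕ.∸ k) !≢0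
  p∣product : p ∣ (p C k) ℕ.* (k ! ℕ.* (p ℕ.∸ k) !)
  p∣product = ≡.subst (p ∣_)
    (≡.sym (≡.trans (≡.cong (ℕ._* (k ! ℕ.* (p ℕ.∸ k) !)) (nCk≡n!/k![n-k]! (ℕ.<⇒≤ k<p)))
                    (m/n*n≡m (k![n∸k]!∣n! (ℕ.<⇒≤ k<p)))))
    (m∣m*n (p-1 !))
... | inj₁ p∣C = p∣C
... | inj₂ p∣k!m! with euclidsLemma (k !) ((p ℕ.∸ k) !) pr p∣k!m!
...   | inj₁ p∣k! = contradiction p∣k! (prime∤! pr k k<p)
...   | inj₂ p∣m! = contradiction p∣m! (prime∤! pr (p ℕ.∸ k) (s≤s (ℕ.m∸n≤m p-1 k-1)))

module PrimeCharacteristic {c ℓ} (R : CommutativeRing c ℓ) {p : ℕ} (pr : Prime p)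
  (p×1≈0 : PowersAndMultiples.CharacteristicDivides R p) where

  open CommutativeRing R hiding (zero)
  open Mult semiring
  open IntegerCoefficients R
  open PowersAndMultiples R
  open Exp commutativeSemiring
  open SetoidReasoning setoid

  ×≈0 : ∀ {n} y → p ∣ n → n × y ≈ 0#
  ×≈0 y (divides q ≡.refl) = begin
    (q ℕ.* p) × y          ≈⟨ ×-assocˡ y q p ⟨
    q × (p × y)            ≈⟨ ×-congʳ q (×-congʳ p (*-identityˡ y)) ⟨
    q × (p × (1# * y))     ≈⟨ ×-congʳ q (×-assoc-* p 1# y) ⟨
    q × ((p × 1#) * y)     ≈⟨ ×-congʳ q (trans (*-congʳ p×1≈0) (zeroˡ y)) ⟩
    q × 0#                 ≈⟨ n×0≈0 q ⟩
    0#                     ∎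

  frobenius : ∀ x y → (x + y) ^ p ≈ x ^ p + y ^ p
  frobenius x y = go p ≡.refl
    where
    open Sum semiring
    open Binomial commutativeSemiring using (theorem; binomialTerm)
    -- The exponent becomes a variable so that it can be matched as a successor, which exposes the
    -- first and last terms of the binomial sum.
    go : ∀ n → n ≡ p → (x + y) ^ n ≈ x ^ n + y ^ n
    go zero 0≡p = contradiction (≡.subst (2 ≤_) (≡.sym 0≡p) (ℕ.nonTrivial⇒n>1 p {{prime⇒nonTrivial pr}})) λ ()
    go n@(suc n-1) ≡.refl = begin
      (x + y) ^ n                                  ≈⟨ theorem n x y ⟩
      term Fin.zero + sum middle+last              ≈⟨ +-congˡ (sum-init-last middle+last) ⟩
      term Fin.zero + (sum middle + last)          ≈⟨ +-cong first≈ (+-cong middle≈ last≈) ⟩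
      y ^ n + (0# + x ^ n)                         ≈⟨ solve 2 (λ a b → b :+ (:0 :+ a) := a :+ b) refl _ _ ⟩
      x ^ n + y ^ n                                ∎
      where
      term = binomialTerm x y n
      middle+last : Fin n → Carrier
      middle+last i = term (Fin.suc i)
      middle : Fin n-1 → Carrier
      middle i = middle+last (Fin.inject₁ i)
      last = middle+last (Fin.fromℕ n-1)
      first≈ : term Fin.zero ≈ y ^ n
      first≈ = trans (+-identityʳ _) (*-identityˡ _)
      last≈ : last ≈ x ^ n
      last≈ rewrite Fin.toℕ-fromℕ n-1 | nCn≡1 n | ℕ.n∸n≡0 n-1 = trans (+-identityʳ _) (*-identityʳ _)
      middle≈ : sum middle ≈ 0#
      middle≈ = trans (sum-cong-≋ {n-1} λ i → ×≈0 _ (prime∣C pr (suc (toℕ (Fin.inject₁ i))) (s≤s z≤n)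
        (s≤s (≡.subst (_< n-1) (≡.sym (Fin.toℕ-inject₁ i)) (Fin.toℕ<n i))))) (sum-replicate-zero n-1)

  -- Applying `frobenius` to (1 - z) + z = 1 avoids the sign (-1)^p, hence any appeal to the parity
  -- of p.
  1-z^p : ∀ z → (1# - z) ^ p ≈ 1# - z ^ p
  1-z^p z = begin
    (1# - z) ^ p                  ≈⟨ solve 2 (λ a b → a := a :+ b :- b) refl _ (z ^ p) ⟩
    (1# - z) ^ p + z ^ p - z ^ p  ≈⟨ +-congʳ (frobenius (1# - z) z) ⟨
    (1# - z + z) ^ p - z ^ p      ≈⟨ +-congʳ (^-congˡ p (solve 1 (λ z → :1 :- z :+ z := :1) refl z)) ⟩
    1# ^ p - z ^ p                ≈⟨ +-congʳ (1^n≈1 p) ⟩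
    1# - z ^ p                    ∎

-- Cancellation for nilpotent q, and the identities of Gauss and Jacobi.

module Nilpotent {c ℓ} (R : CommutativeRing c ℓ) where
  open CommutativeRing R hiding (zero)
  open IntegerCoefficients R
  open FiniteTripleProduct R
  open Exp commutativeSemiring
  open Mult semiring
  open GroupProperties +-group using (x∙y⁻¹≈ε⇒x≈y)
  open SetoidReasoning setoid

  -- A subgroup and not an ideal: multiplication by q moves the residue class of the exponents, so
  -- the vanishing series are stable only under powers of q^p.
  record IsAdditive {q} (S : Carrier → Set q) : Set (c ⊔ ℓ ⊔ q) where
    field
      resp : ∀ {f g} → f ≈ g → S f → S g
      0-closed : S 0#
      +-closed : ∀ {f g} → S f → S g → S (f + g)
      -‿closed : ∀ {f} → S f → S (- f)

    ∑-closed : ∀ n {f} → (∀ k → S (f k)) → S (∑< n f)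
    ∑-closed zero Sf = 0-closed
    ∑-closed (suc n) Sf = +-closed (∑-closed n Sf) (Sf n)

    ×-closed : ∀ n {f} → S f → S (f * (n × 1#))
    ×-closed zero Sf = resp (sym (zeroʳ _)) 0-closed
    ×-closed (suc n) Sf = resp (trans (+-congʳ (sym (*-identityʳ _))) (sym (distribˡ _ _ _)))
                            (+-closed Sf (×-closed n Sf))

    ±-closed : ∀ n {f} → S f → S (f * (- 1#) ^ n)
    ±-closed zero Sf = resp (sym (*-identityʳ _)) Sf
    ±-closed (suc n) {f} Sf = resp
      (solve 2 (λ f s → :- (f :* s) := f :* (:- :1 :* s)) refl f ((- 1#) ^ n))
      (-‿closed (±-closed n Sf))

    -- Induction leads from f (1 - z) to f (1 - z^m) for every m, and m = M gives f itself.
    1-z-cancel : ∀ {z M} → z ^ M ≈ 0# → (∀ {f} → S f → S (f * z)) → ∀ {f} → S (f * (1# - z)) → S f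
    1-z-cancel {z} {M} z^M≈0 Sz {f} Sf = resp
      (trans (*-congˡ (+-congˡ (-‿cong z^M≈0))) (solve 1 (λ f → f :* (:1 :- :0) := f) refl f))
      (geometric M)
      where
      geometric : ∀ m → S (f * (1# - z ^ m))
      geometric zero = resp (solve 1 (λ f → :0 := f :* (:1 :- :1)) refl f) 0-closed
      geometric (suc m) = resp
        (solve 3 (λ f z w → f :* (:1 :- z) :+ f :* (:1 :- w) :* z := f :* (:1 :- z :* w)) refl f z (z ^ m))
        (+-closed Sf (Sz (geometric m)))

    -- Each 1 - z i has the inverse 1 + z i + z i ² + …, a finite sum.
    ∏-cancel : ∀ n (z : ℕ → Carrier) M → (∀ i → z (suc i) ^ M ≈ 0#) → (∀ i {f} → S f → S (f * z (suc i))) →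
      ∀ {f} → S (f * ∏≤ n (λ i → 1# - z i)) → S f
    ∏-cancel zero z M z^M≈0 Sz Sf = resp (*-identityʳ _) Sf
    ∏-cancel (suc n) z M z^M≈0 Sz Sf = ∏-cancel n z M z^M≈0 Sz
      (1-z-cancel {M = M} (z^M≈0 n) (Sz n) (resp (sym (*-assoc _ _ _)) Sf))

  ≈0-isAdditive : IsAdditive (_≈ 0#)
  ≈0-isAdditive = record
    { resp = λ f≈g f≈0 → trans (sym f≈g) f≈0
    ; 0-closed = refl
    ; +-closed = λ f≈0 g≈0 → trans (+-cong f≈0 g≈0) (+-identityʳ 0#)
    ; -‿closed = λ f≈0 → trans (-‿cong f≈0) (solve 0 (:- :0 := :0) refl)
    }

  *-nilpotent : ∀ {z} w M → z ^ M ≈ 0# → (z * w) ^ M ≈ 0#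
  *-nilpotent {z} w M z^M≈0 = trans (^-distrib-* z w M) (trans (*-congʳ z^M≈0) (zeroˡ _))

  module _ {x : Carrier} {M : ℕ} (x^M≈0 : x ^ M ≈ 0#) where

    x^[M+j]≈0 : ∀ j → x ^ (M ℕ.+ j) ≈ 0#
    x^[M+j]≈0 j = trans (^-homo-* x M j) (trans (*-congʳ x^M≈0) (zeroˡ _))

    x^j≈0 : ∀ {j} → M ≤ j → x ^ j ≈ 0#
    x^j≈0 {j} M≤j = ≡.subst (λ i → x ^ i ≈ 0#) (ℕ.m+[n∸m]≡n M≤j) (x^[M+j]≈0 (j ℕ.∸ M))

    -- The case of `∏-cancel` in which the group is zero.
    poch-cancel : ∀ n {f} → f * poch x n ≈ 0# → f ≈ 0#
    poch-cancel n = IsAdditive.∏-cancel ≈0-isAdditive n (x ^_) M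
      (λ i → *-nilpotent (x ^ i) M x^M≈0)
      (λ i f≈0 → trans (*-congʳ f≈0) (zeroˡ _))

    poch-cancel-≈ : ∀ n {f g} → f * poch x n ≈ g * poch x n → f ≈ g
    poch-cancel-≈ n {f} {g} fP≈gP = x∙y⁻¹≈ε⇒x≈y f g (poch-cancel n (begin
      (f - g) * poch x n              ≈⟨ solve 3 (λ f g p → (f :- g) :* p := f :* p :- g :* p) refl f g (poch x n) ⟩
      f * poch x n - g * poch x n     ≈⟨ +-congʳ fP≈gP ⟩
      g * poch x n - g * poch x n     ≈⟨ -‿inverseʳ _ ⟩
      0#                              ∎))

    poch-stable : ∀ {n} → M ≤ n → poch x n ≈ poch x M
    poch-stable {n} M≤n = ≡.subst (λ i → poch x i ≈ poch x M) (ℕ.m+[n∸m]≡n M≤n) (go (n ℕ.∸ M))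
      where
      go : ∀ j → poch x (M ℕ.+ j) ≈ poch x M
      go zero rewrite ℕ.+-identityʳ M = refl
      go (suc j) rewrite ℕ.+-suc M j = begin
        poch x (M ℕ.+ j) * (1# - x ^ suc (M ℕ.+ j))
          ≈⟨ *-cong (go j) (+-congˡ (-‿cong (x^j≈0 (ℕ.m≤n⇒m≤1+n (ℕ.m≤m+n M j))))) ⟩
        poch x M * (1# - 0#)
          ≈⟨ solve 1 (λ p → p :* (:1 :- :0) := p) refl _ ⟩
        poch x M ∎

    -- Each factor beyond the m-th is 1 minus a multiple of x^(m+1), which f annihilates.
    poch-absorb : ∀ {f} m j → f * x ^ suc m ≈ 0# → f * poch x (m ℕ.+ j) ≈ f * poch x m
    poch-absorb m zero fx≈0 rewrite ℕ.+-identityʳ m = refl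
    poch-absorb {f} m (suc j) fx≈0 rewrite ℕ.+-suc m j = begin
      f * (p * (1# - x * x ^ (m ℕ.+ j)))
        ≈⟨ *-congˡ (*-congˡ (+-congˡ (-‿cong (*-congˡ (^-homo-* x m j))))) ⟩
      f * (p * (1# - x * (x ^ m * x ^ j)))
        ≈⟨ solve 5 (λ f p x a b → f :* (p :* (:1 :- x :* (a :* b))) := f :* p :- f :* (x :* a) :* (p :* b))
             refl f p x (x ^ m) (x ^ j) ⟩
      f * p - f * (x * x ^ m) * (p * x ^ j)
        ≈⟨ +-cong (poch-absorb m j fx≈0) (-‿cong (*-congʳ fx≈0)) ⟩
      f * poch x m - 0# * (p * x ^ j)
        ≈⟨ solve 2 (λ a b → a :- :0 :* b := a) refl _ _ ⟩
      f * poch x m ∎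
      where p = poch x (m ℕ.+ j)

    -- Stands for the limit of [2n+1 choose n-k], which is 1 / (x; x)_∞. In `d-closed` both long
    -- products equal `poch x M` and cancel, leaving `poch x m` with m = M - k; the missing factors
    -- act trivially on `D`.
    d-limit : ∀ {k} → k ≤ M → d x M k * poch x M ≈ x ^ triangle k
    d-limit {k} k≤M = begin
      D * poch x M           ≡⟨ ≡.cong (λ i → D * poch x i) m+k≡M ⟨
      D * poch x (m ℕ.+ k)   ≈⟨ poch-absorb m k D*x≈0 ⟩
      D * poch x m           ≈⟨ D*Pm≈ ⟩
      x ^ triangle k         ∎
      where
      D = d x M k
      m = M ℕ.∸ k
      m+k≡M = ℕ.m∸n+n≡m k≤M
      D*Pm≈ : D * poch x m ≈ x ^ triangle k
      D*Pm≈ = poch-cancel-≈ M (begin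
        D * poch x m * poch x M                       ≈⟨ *-congˡ (poch-stable (ℕ.m≤n⇒m≤1+n (ℕ.m≤m+n M k))) ⟨
        D * poch x m * poch x (suc (M ℕ.+ k))         ≈⟨ solve 3 (λ a b c → a :* b :* c := b :* c :* a) refl _ _ _ ⟩
        poch x m * poch x (suc (M ℕ.+ k)) * D         ≈⟨ d-closed x M m k m+k≡M ⟩
        poch x (suc (M ℕ.+ M)) * x ^ triangle k       ≈⟨ *-congʳ (poch-stable (ℕ.m≤n⇒m≤1+n (ℕ.m≤m+n M M))) ⟩
        poch x M * x ^ triangle k                     ≈⟨ *-comm _ _ ⟩
        x ^ triangle k * poch x M                     ∎)
      M≤ : M ≤ suc m ℕ.+ triangle k
      M≤ = ℕ.≤-trans (ℕ.≤-reflexive (≡.sym m+k≡M)) (ℕ.m≤n⇒m≤1+n (ℕ.+-monoʳ-≤ m (k≤triangle k)))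
      -- Up to a unit `D` is x^(triangle k), and m + 1 + triangle k exceeds M because triangle k is
      -- at least k.
      D*x≈0 : D * x ^ suc m ≈ 0#
      D*x≈0 = poch-cancel m (begin
        D * x ^ suc m * poch x m             ≈⟨ solve 3 (λ a b c → a :* b :* c := b :* (a :* c)) refl _ _ _ ⟩
        x ^ suc m * (D * poch x m)           ≈⟨ *-congˡ D*Pm≈ ⟩
        x ^ suc m * x ^ triangle k           ≈⟨ ^-homo-* x (suc m) (triangle k) ⟨
        x ^ (suc m ℕ.+ triangle k)           ≈⟨ x^j≈0 M≤ ⟩
        0#                                   ∎)

    -- Since x^M = 0, row M of the finite identity is already the limit.
    triple-product : ∀ t c → c 0 ≈ 1# → c 1 ≈ - (t + 1#) →
      (∀ k → c (suc (suc k)) ≈ - (t * c (suc k)) - c k) →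
      ∑< (suc M) (λ k → c k * x ^ triangle k)
        ≈ poch x M * ∏≤ M (λ i → 1# - t * x ^ i + x ^ i * x ^ i)
    triple-product t c c₀ c₁ c₊ = begin
      ∑< (suc M) (λ k → c k * x ^ triangle k)
        ≈⟨ ∑-cong (suc M) (λ k k≤M → trans (*-congˡ (sym (d-limit (ℕ.≤-pred k≤M))))
             (solve 3 (λ a b c → a :* (b :* c) := c :* (a :* b)) refl _ _ _)) ⟩
      ∑< (suc M) (λ k → poch x M * (c k * d x M k))
        ≈⟨ *-distribˡ-∑ (suc M) (poch x M) _ ⟨
      poch x M * ∑< (suc M) (λ k → c k * d x M k)
        ≈⟨ *-congˡ (finite-triple-product x t c c₀ c₁ c₊ M M ℕ.≤-refl) ⟩
      poch x M * ∏≤ M (λ i → 1# - t * x ^ i + x ^ i * x ^ i) ∎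

    -- At t = -2 every coefficient c(k) is 1 and each factor is (1 + x^i)², which combines with two
    -- copies of 1 - x^i into (1 - x^(2i))².
    gauss : poch x M * ∑< (suc M) (λ k → x ^ triangle k) ≈ poch (x * x) M * poch (x * x) M
    gauss = begin
      poch x M * ∑< (suc M) (λ k → x ^ triangle k)
        ≈⟨ *-congˡ (∑-cong (suc M) (λ k _ → sym (*-identityˡ _))) ⟩
      poch x M * ∑< (suc M) (λ k → 1# * x ^ triangle k)
        ≈⟨ *-congˡ (triple-product t (λ _ → 1#) refl
             (solve 0 (:1 := :- (:- (:1 :+ :1) :+ :1)) refl)
             (λ _ → solve 0 (:1 := :- (:- (:1 :+ :1) :* :1) :- :1) refl)) ⟩
      poch x M * (poch x M * ∏≤ M (λ i → 1# - t * x ^ i + x ^ i * x ^ i))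
        ≈⟨ trans (*-congˡ (∏-* M _ _)) (∏-* M _ _) ⟩
      ∏≤ M (λ i → (1# - x ^ i) * ((1# - x ^ i) * (1# - t * x ^ i + x ^ i * x ^ i)))
        ≈⟨ ∏-cong M (λ i → trans
             (solve 1 (λ q → (:1 :- q) :* ((:1 :- q) :* (:1 :- (:- (:1 :+ :1)) :* q :+ q :* q))
                             := (:1 :- q :* q) :* (:1 :- q :* q)) refl (x ^ suc i))
             (*-cong (+-congˡ (-‿cong (sym (^-distrib-* x x (suc i)))))
                     (+-congˡ (-‿cong (sym (^-distrib-* x x (suc i))))))) ⟩
      ∏≤ M (λ i → (1# - (x * x) ^ i) * (1# - (x * x) ^ i))
        ≈⟨ ∏-* M _ _ ⟨
      poch (x * x) M * poch (x * x) M ∎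
      where t = - (1# + 1#)

    -- At t = 2 the sum z^(-k) + ... + z^k becomes 2k + 1 and each factor is (1 - x^i)².
    jacobi : ∑< (suc M) (λ k → (- 1#) ^ k * (suc (k ℕ.+ k) × 1#) * x ^ triangle k)
             ≈ poch x M * (poch x M * poch x M)
    jacobi = begin
      ∑< (suc M) (λ k → coeff k * x ^ triangle k)
        ≈⟨ triple-product (1# + 1#) coeff
             (solve 0 (:1 :* (:1 :+ :0) := :1) refl)
             (solve 0 (:- :1 :* :1 :* (:1 :+ (:1 :+ (:1 :+ :0))) := :- (:1 :+ :1 :+ :1)) refl)
             c₊ ⟩
      poch x M * ∏≤ M (λ i → 1# - (1# + 1#) * x ^ i + x ^ i * x ^ i)
        ≈⟨ *-congˡ (∏-cong M (λ i → solve 1 (λ q → :1 :- (:1 :+ :1) :* q :+ q :* q := (:1 :- q) :* (:1 :- q))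
             refl (x ^ suc i))) ⟩
      poch x M * ∏≤ M (λ i → (1# - x ^ i) * (1# - x ^ i))
        ≈⟨ *-congˡ (∏-* M _ _) ⟨
      poch x M * (poch x M * poch x M) ∎
      where
      coeff : ℕ → Carrier
      coeff k = (- 1#) ^ k * (suc (k ℕ.+ k) × 1#)
      c₊ : ∀ k → coeff (suc (suc k)) ≈ - ((1# + 1#) * coeff (suc k)) - coeff k
      c₊ k rewrite ℕ.+-suc k (suc k) | ℕ.+-suc k k =
        solve 2 (λ s u → :- :1 :* (:- :1 :* s) :* (:1 :+ (:1 :+ (:1 :+ (:1 :+ (:1 :+ u)))))
                         := :- ((:1 :+ :1) :* (:- :1 :* s :* (:1 :+ (:1 :+ (:1 :+ u))))) :- s :* (:1 :+ u))
          refl ((- 1#) ^ k) ((k ℕ.+ k) × 1#)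

-- The product identity modulo p and division by the p-th power of f₂.

module CubicPartitionSeries {c ℓ} (R : CommutativeRing c ℓ)
  {r : ℕ} (pr : Prime (5 ℕ.+ r))
  (p×1≈0 : PowersAndMultiples.CharacteristicDivides R (5 ℕ.+ r)) where

  open CommutativeRing R hiding (zero)
  open Mult semiring
  open Exp commutativeSemiring
  open IntegerCoefficients R
  open FiniteTripleProduct R
  open Nilpotent R
  open PowersAndMultiples R
  open PrimeCharacteristic R pr p×1≈0
  open SetoidReasoning setoid

  private
    -- In this form p - 5 is `r` and p - 4 is `suc r`, with no truncated subtraction.
    p : ℕ
    p = 5 ℕ.+ r

  module AtNilpotent {x : Carrier} {M : ℕ} (x^M≈0 : x ^ M ≈ 0#) where

    private
      y : Carrier
      y = x * x

      y^M≈0 : y ^ M ≈ 0#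
      y^M≈0 = *-nilpotent x M x^M≈0

    f₁ f₂ ψ J : Carrier
    f₁ = poch x M
    f₂ = poch (x * x) M
    ψ = ∑< (suc M) (λ j → x ^ triangle j)
    J = ∑< (suc M) (λ k → (- 1#) ^ k * (suc (k ℕ.+ k) × 1#) * (x * x) ^ triangle k)

    -- The exponent p - 5 falls five short of p. Of the five factors f₂ supplied, two turn into f₁ ψ
    -- by `gauss` and three into J by `jacobi` at x².
    G*f₂^p≈ψ*J : ∀ {G} → G * (f₁ * f₂ ^ r) ≈ 1# → G * f₂ ^ p ≈ ψ * J
    G*f₂^p≈ψ*J {G} G-inv = begin
      G * (e * (e * (e * (e * (e * e ^ r)))))
        ≈⟨ solve 3 (λ g e w → g :* (e :* (e :* (e :* (e :* (e :* w))))) := g :* (e :* e) :* w :* (e :* (e :* e))) refl G e (e ^ r) ⟩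
      G * (e * e) * e ^ r * (e * (e * e))
        ≈⟨ *-cong (*-congʳ (*-congˡ (sym (gauss {x} {M} x^M≈0)))) (sym (jacobi {y} {M} y^M≈0)) ⟩
      G * (f₁ * ψ) * e ^ r * J
        ≈⟨ solve 5 (λ g f s w j → g :* (f :* s) :* w :* j := g :* (f :* w) :* (s :* j)) refl G f₁ ψ (e ^ r) J ⟩
      G * (f₁ * e ^ r) * (ψ * J)
        ≈⟨ trans (*-congʳ G-inv) (*-identityˡ _) ⟩
      ψ * J ∎
      where e = f₂

    f₂^p≈ : f₂ ^ p ≈ ∏≤ M (λ i → 1# - (y ^ i) ^ p)
    f₂^p≈ = go M
      where
      go : ∀ n → poch y n ^ p ≈ ∏≤ n (λ i → 1# - (y ^ i) ^ p)
      go zero = 1^n≈1 p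
      go (suc n) = trans (^-distrib-* _ _ p) (*-cong (go n) (1-z^p _))

    module _ {s} {S : Carrier → Set s} (S-additive : IsAdditive S)
      (x^p-closed : ∀ {f} → S f → S (f * x ^ p))
      (monomial : ∀ j k → ¬ p ∣ suc (k ℕ.+ k) → S (x ^ triangle j * y ^ triangle k)) where

      open IsAdditive S-additive

      -- A term with p dividing 2k + 1 has coefficient zero in characteristic p, so membership of
      -- its monomial is not at issue; the others are signed multiples of monomials in S.
      ψ*J∈S : S (ψ * J)
      ψ*J∈S = resp (sym (*-distribˡ-∑ (suc M) ψ _)) (∑-closed (suc M) λ k →
        resp (trans (sym (*-distribˡ-∑ (suc M) _ _)) (*-comm _ _)) (∑-closed (suc M) λ j → term j k))
        where
        term : ∀ j k → S ((- 1#) ^ k * (suc (k ℕ.+ k) × 1#) * y ^ triangle k * x ^ triangle j)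
        term j k with p ∣? suc (k ℕ.+ k)
        ... | yes p∣2k+1 = resp (sym (trans (*-congʳ (*-congʳ (*-congˡ (×≈0 1# p∣2k+1))))
                (solve 3 (λ a b c → a :* :0 :* b :* c := :0) refl _ _ _))) 0-closed
        ... | no p∤2k+1 = resp
                (solve 4 (λ a b c d → d :* c :* b :* a := a :* b :* c :* d) refl _ _ _ _)
                (±-closed k (×-closed (suc (k ℕ.+ k)) (monomial j k p∤2k+1)))

      x^p-multiple-closed : ∀ n {f} → S f → S (f * (x ^ p) ^ n)
      x^p-multiple-closed zero Sf = resp (sym (*-identityʳ _)) Sf
      x^p-multiple-closed (suc n) Sf = resp (*-assoc _ _ _) (x^p-multiple-closed n (x^p-closed Sf))

      -- By `f₂^p≈` the product G f₂^p in S differs from G by factors 1 - z with z = (x^p)^(2i), and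
      -- `∏-cancel` removes them.
      inverse∈S : ∀ {G} → G * (f₁ * f₂ ^ r) ≈ 1# → S G
      inverse∈S G-inv = ∏-cancel M (λ i → (y ^ i) ^ p) M
        (λ i → *-nilpotent _ M (*-nilpotent (y ^ i) M y^M≈0))
        (λ i Sf → resp (*-congˡ (y^i^p i)) (x^p-multiple-closed (suc i ℕ.+ suc i) Sf))
        (resp (sym (trans (*-congˡ (sym f₂^p≈)) (G*f₂^p≈ψ*J G-inv))) ψ*J∈S)
        where
        y^i^p : ∀ i → (x ^ p) ^ (suc i ℕ.+ suc i) ≈ (y ^ suc i) ^ p
        y^i^p i = begin
          (x ^ p) ^ (suc i ℕ.+ suc i)         ≈⟨ ^-assocʳ x p (suc i ℕ.+ suc i) ⟩
          x ^ (p ℕ.* (suc i ℕ.+ suc i))       ≡⟨ ≡.cong (x ^_) (ℕ.*-comm p (suc i ℕ.+ suc i)) ⟩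
          x ^ ((suc i ℕ.+ suc i) ℕ.* p)       ≈⟨ ^-assocʳ x (suc i ℕ.+ suc i) p ⟨
          (x ^ (suc i ℕ.+ suc i)) ^ p         ≈⟨ ^-congˡ p (^-homo-* x (suc i) (suc i)) ⟩
          (x ^ suc i * x ^ suc i) ^ p         ≈⟨ ^-congˡ p (^-distrib-* x x (suc i)) ⟨
          (y ^ suc i) ^ p                     ∎

-- Since -1 = n - 1 in ℤ/n, residues need no integers.
ℕ-mod : ∀ n .{{_ : NonZero n}} → CommutativeRing 0ℓ 0ℓ
ℕ-mod n = record
  { Carrier = ℕ
  ; _≈_ = λ a b → a % n ≡ b % n
  ; _+_ = ℕ._+_
  ; _*_ = ℕ._*_
  ; -_ = λ a → ℕ.pred n ℕ.* a
  ; 0# = 0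
  ; 1# = 1
  ; isCommutativeRing = record
    { isRing = record
      { +-isAbelianGroup = record
        { isGroup = record
          { isMonoid = record
            { isSemigroup = record
              { isMagma = record
                { isEquivalence = On.isEquivalence (_% n) ≡.isEquivalence
                ; ∙-cong = +-cong }
              ; assoc = λ a b c → ≡.cong (_% n) (ℕ.+-assoc a b c) }
            ; identity = (λ a → ≡.refl) , (λ a → ≡.cong (_% n) (ℕ.+-identityʳ a)) }
          ; inverse = (λ a → ≡.trans (≡.cong (_% n) (ℕ.+-comm _ a)) (inverseʳ a)) , inverseʳ
          ; ⁻¹-cong = λ {a} {b} a≈b → *-cong {ℕ.pred n} {ℕ.pred n} {a} {b} ≡.refl a≈b }
        ; comm = λ a b → ≡.cong (_% n) (ℕ.+-comm a b) }
      ; *-cong = *-cong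
      ; *-assoc = λ a b c → ≡.cong (_% n) (ℕ.*-assoc a b c)
      ; *-identity = (λ a → ≡.cong (_% n) (ℕ.*-identityˡ a)) , (λ a → ≡.cong (_% n) (ℕ.*-identityʳ a))
      ; distrib = (λ a b c → ≡.cong (_% n) (ℕ.*-distribˡ-+ a b c)) , (λ a b c → ≡.cong (_% n) (ℕ.*-distribʳ-+ a b c))
      }
    ; *-comm = λ a b → ≡.cong (_% n) (ℕ.*-comm a b)
    }
  }
  where
  +-cong : ∀ {a b c d} → a % n ≡ b % n → c % n ≡ d % n → (a ℕ.+ c) % n ≡ (b ℕ.+ d) % n
  +-cong {a} {b} {c} {d} a≈b c≈d = ≡.trans (%-distribˡ-+ a c n)
    (≡.trans (≡.cong₂ (λ u v → (u ℕ.+ v) % n) a≈b c≈d) (≡.sym (%-distribˡ-+ b d n)))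
  *-cong : ∀ {a b c d} → a % n ≡ b % n → c % n ≡ d % n → (a ℕ.* c) % n ≡ (b ℕ.* d) % n
  *-cong {a} {b} {c} {d} a≈b c≈d = ≡.trans (%-distribˡ-* a c n)
    (≡.trans (≡.cong₂ (λ u v → (u ℕ.* v) % n) a≈b c≈d) (≡.sym (%-distribˡ-* b d n)))
  inverseʳ : ∀ a → (a ℕ.+ ℕ.pred n ℕ.* a) % n ≡ 0 % n
  inverseʳ a = ≡.trans
    (≡.cong (_% n) (≡.trans (≡.cong (ℕ._* a) (ℕ.suc-pred n)) (ℕ.*-comm n a)))
    (≡.trans (m*n%n≡0 a n) (≡.sym (m*n%n≡0 0 n)))

-- Formal power series and their truncations.

module PowerSeries {c ℓ} (K : CommutativeRing c ℓ) where
  open CommutativeRing K hiding (zero)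
  open CommutativeSemigroupProperties +-commutativeSemigroup using (x∙yz≈y∙xz; interchange)
  open SetoidReasoning setoid

  Series : Set c
  Series = ℕ → Carrier

  infix 4 _≋_
  infixl 7 _✶_
  infixl 6 _⊕_

  _≋_ : Series → Series → Set ℓ
  f ≋ g = ∀ n → f n ≈ g n

  -- The Cauchy product, read off from f = f(0) + X (f ∘ suc) by recursion on the degree, without
  -- sums over pairs of indices.
  _✶_ _⊕_ : Series → Series → Series
  (f ✶ g) zero = f 0 * g 0
  (f ✶ g) (suc n) = f 0 * g (suc n) + ((f ∘ suc) ✶ g) n
  (f ⊕ g) n = f n + g n

  ⊖_ : Series → Series
  (⊖ f) n = - f n

  𝟘 𝟙 X : Series
  𝟘 _ = 0#
  𝟙 zero = 1#
  𝟙 (suc n) = 0#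
  X zero = 0#
  X (suc n) = 𝟙 n

  -- Coefficient n of a product sees only coefficients up to n; hence multiplication respects
  -- equality modulo X^M.
  ✶-cong-≤ : ∀ n {f g h k} → (∀ m → m ≤ n → f m ≈ g m) → (∀ m → m ≤ n → h m ≈ k m) →
    (f ✶ h) n ≈ (g ✶ k) n
  ✶-cong-≤ zero f≈g h≈k = *-cong (f≈g 0 z≤n) (h≈k 0 z≤n)
  ✶-cong-≤ (suc n) f≈g h≈k = +-cong (*-cong (f≈g 0 z≤n) (h≈k (suc n) ℕ.≤-refl))
    (✶-cong-≤ n (λ m m≤n → f≈g (suc m) (s≤s m≤n)) (λ m m≤n → h≈k m (ℕ.m≤n⇒m≤1+n m≤n)))

  ✶-distribʳ : ∀ h f g → (f ⊕ g) ✶ h ≋ f ✶ h ⊕ g ✶ h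
  ✶-distribʳ h f g zero = distribʳ _ _ _
  ✶-distribʳ h f g (suc n) = trans
    (+-cong (distribʳ _ _ _) (✶-distribʳ h (f ∘ suc) (g ∘ suc) n)) (interchange _ _ _ _)

  ✶-scaleˡ : ∀ a f g → (λ n → a * f n) ✶ g ≋ (λ n → a * (f ✶ g) n)
  ✶-scaleˡ a f g zero = *-assoc _ _ _
  ✶-scaleˡ a f g (suc n) = trans (+-cong (*-assoc _ _ _) (✶-scaleˡ a (f ∘ suc) g n)) (sym (distribˡ _ _ _))

  ✶-assoc : ∀ f g h → (f ✶ g) ✶ h ≋ f ✶ (g ✶ h)
  ✶-assoc f g h zero = *-assoc _ _ _
  ✶-assoc f g h (suc n) = begin
    f 0 * g 0 * h (suc n) + (((λ n → f 0 * g (suc n)) ⊕ (f ∘ suc) ✶ g) ✶ h) n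
      ≈⟨ +-cong (*-assoc _ _ _) (✶-distribʳ h (λ n → f 0 * g (suc n)) ((f ∘ suc) ✶ g) n) ⟩
    f 0 * (g 0 * h (suc n)) + (((λ n → f 0 * g (suc n)) ✶ h) n + (((f ∘ suc) ✶ g) ✶ h) n)
      ≈⟨ +-congˡ (+-cong (✶-scaleˡ (f 0) (g ∘ suc) h n) (✶-assoc (f ∘ suc) g h n)) ⟩
    f 0 * (g 0 * h (suc n)) + (f 0 * ((g ∘ suc) ✶ h) n + ((f ∘ suc) ✶ (g ✶ h)) n)
      ≈⟨ +-assoc _ _ _ ⟨
    f 0 * (g 0 * h (suc n)) + f 0 * ((g ∘ suc) ✶ h) n + ((f ∘ suc) ✶ (g ✶ h)) n
      ≈⟨ +-congʳ (distribˡ _ _ _) ⟨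
    f 0 * (g 0 * h (suc n) + ((g ∘ suc) ✶ h) n) + ((f ∘ suc) ✶ (g ✶ h)) n ∎

  -- The mirror image of the defining recursion, peeling off the right factor; commutativity follows
  -- by comparing the two.
  ✶-sucʳ : ∀ f g n → (f ✶ g) (suc n) ≈ g 0 * f (suc n) + (f ✶ (g ∘ suc)) n
  ✶-sucʳ f g zero = trans (+-comm _ _) (+-congʳ (*-comm _ _))
  ✶-sucʳ f g (suc n) = trans (+-congˡ (✶-sucʳ (f ∘ suc) g n)) (x∙yz≈y∙xz _ _ _)

  ✶-comm : ∀ f g → f ✶ g ≋ g ✶ f
  ✶-comm f g zero = *-comm _ _
  ✶-comm f g (suc n) = trans (+-congˡ (✶-comm (f ∘ suc) g n)) (sym (✶-sucʳ g f n))

  𝟘-✶ : ∀ f → 𝟘 ✶ f ≋ 𝟘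
  𝟘-✶ f zero = zeroˡ _
  𝟘-✶ f (suc n) = trans (+-cong (zeroˡ _) (𝟘-✶ f n)) (+-identityʳ 0#)

  𝟙-✶ : ∀ f → 𝟙 ✶ f ≋ f
  𝟙-✶ f zero = *-identityˡ _
  𝟙-✶ f (suc n) = trans (+-cong (*-identityˡ _) (𝟘-✶ f n)) (+-identityʳ _)

  X-✶-suc : ∀ f n → (X ✶ f) (suc n) ≈ f n
  X-✶-suc f n = trans (+-cong (zeroˡ _) (𝟙-✶ f n)) (+-identityˡ _)

  -- The quotient by X^M, formed by coarsening the equality and keeping full series as carrier.
  truncated : ℕ → CommutativeRing c ℓ
  truncated M = record
    { Carrier = Series
    ; _≈_ = λ f g → ∀ n → n < M → f n ≈ g n
    ; _+_ = _⊕_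
    ; _*_ = _✶_
    ; -_ = ⊖_
    ; 0# = 𝟘
    ; 1# = 𝟙
    ; isCommutativeRing = record
      { isRing = record
        { +-isAbelianGroup = record
          { isGroup = record
            { isMonoid = record
              { isSemigroup = record
                { isMagma = record
                  { isEquivalence = record
                    { refl = λ n n<M → refl
                    ; sym = λ f≈g n n<M → sym (f≈g n n<M)
                    ; trans = λ f≈g g≈h n n<M → trans (f≈g n n<M) (g≈h n n<M) }
                  ; ∙-cong = λ f≈g h≈k n n<M → +-cong (f≈g n n<M) (h≈k n n<M) }
                ; assoc = λ f g h n n<M → +-assoc _ _ _ }
              ; identity = (λ f n n<M → +-identityˡ _) , (λ f n n<M → +-identityʳ _) }
            ; inverse = (λ f n n<M → -‿inverseˡ _) , (λ f n n<M → -‿inverseʳ _)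
            ; ⁻¹-cong = λ f≈g n n<M → -‿cong (f≈g n n<M) }
          ; comm = λ f g n n<M → +-comm _ _ }
        ; *-cong = λ f≈g h≈k n n<M → ✶-cong-≤ n
            (λ m m≤n → f≈g m (ℕ.≤-<-trans m≤n n<M)) (λ m m≤n → h≈k m (ℕ.≤-<-trans m≤n n<M))
        ; *-assoc = λ f g h n n<M → ✶-assoc f g h n
        ; *-identity = (λ f n n<M → 𝟙-✶ f n) , (λ f n n<M → trans (✶-comm f 𝟙 n) (𝟙-✶ f n))
        ; distrib = (λ f g h n n<M → trans (✶-comm f (g ⊕ h) n)
                       (trans (✶-distribʳ f g h n) (+-cong (✶-comm g f n) (✶-comm h f n))))
                  , (λ f g h n n<M → ✶-distribʳ f g h n) }
      ; *-comm = λ f g n n<M → ✶-comm f g n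
      }
    }

  module _ (M : ℕ) where
    open Exp (CommutativeRing.commutativeSemiring (truncated M)) using (_^_)
    open Mult (CommutativeRing.semiring (truncated M)) using (_×_)
    open Mult semiring using () renaming (_×_ to _×ᴷ_)

    -- Powers are those of `truncated M`, but its product is the product of full series, so these
    -- coefficient formulas hold at every index.
    X^k-< : ∀ k {n} f → n < k → (X ^ k ✶ f) n ≈ 0#
    X^k-< (suc k) {zero} f n<k = trans (✶-assoc X (X ^ k) f 0) (zeroˡ _)
    X^k-< (suc k) {suc n} f (s≤s n<k) =
      trans (✶-assoc X (X ^ k) f (suc n)) (trans (X-✶-suc (X ^ k ✶ f) n) (X^k-< k f n<k))

    X^k-+ : ∀ k n f → (X ^ k ✶ f) (k ℕ.+ n) ≈ f n
    X^k-+ zero n f = 𝟙-✶ f n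
    X^k-+ (suc k) n f =
      trans (✶-assoc X (X ^ k) f (suc (k ℕ.+ n))) (trans (X-✶-suc (X ^ k ✶ f) (k ℕ.+ n)) (X^k-+ k n f))

    X^k-≢ : ∀ k n → n ≢ k → (X ^ k) n ≈ 0#
    X^k-≢ zero zero n≢k = contradiction ≡.refl n≢k
    X^k-≢ zero (suc n) n≢k = refl
    X^k-≢ (suc k) zero n≢k = zeroˡ _
    X^k-≢ (suc k) (suc n) n≢k = trans (X-✶-suc (X ^ k) n) (X^k-≢ k n (n≢k ∘ ≡.cong suc))

    X^M≈𝟘 : ∀ n → n < M → (X ^ M) n ≈ 0#
    X^M≈𝟘 n n<M = X^k-≢ M n (ℕ.<⇒≢ n<M)

    ×𝟙-coeff : ∀ k → k × 𝟙 ≋ (λ n → k ×ᴷ 𝟙 n)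
    ×𝟙-coeff zero n = refl
    ×𝟙-coeff (suc k) n = +-congˡ (×𝟙-coeff k n)

-- Minus two is not a square modulo 5 or 7 mod 8.

module MinusTwoIsNonresidue where
  open import Data.Product using (_×_)
  open import Data.Nat
  open import Data.Nat.Properties
  open import Relation.Binary.PropositionalEquality

  -- Stated for any n, since the descent passes to cofactors that may be composite.
  5or7 : ℕ → Set
  5or7 n = n % 8 ≡ 5 ⊎ n % 8 ≡ 7

  odd-square : ∀ j → suc (j + j) * suc (j + j) ≡ 8 * triangle j + 1
  odd-square zero = refl
  odd-square (suc j) = begin
    suc (suc j + suc j) * suc (suc j + suc j)     ≡⟨ eq₁ j ⟩
    suc (j + j) * suc (j + j) + 8 * suc j         ≡⟨ cong (_+ 8 * suc j) (odd-square j) ⟩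
    8 * triangle j + 1 + 8 * suc j                ≡⟨ eq₂ j (triangle j) ⟩
    8 * (suc j + triangle j) + 1                  ∎
    where
    open ≡-Reasoning
    eq₁ : ∀ j → suc (suc j + suc j) * suc (suc j + suc j) ≡ suc (j + j) * suc (j + j) + 8 * suc j
    eq₁ = solve-∀
    eq₂ : ∀ j t → 8 * t + 1 + 8 * suc j ≡ 8 * (suc j + t) + 1
    eq₂ = solve-∀

  halve : ∀ n → ∃[ j ] (n ≡ j + j ⊎ n ≡ suc (j + j))
  halve zero = 0 , inj₁ refl
  halve (suc n) with halve n
  ... | j , inj₁ refl = j , inj₂ refl
  ... | j , inj₂ refl = suc j , inj₁ (cong suc (sym (+-suc j j)))

  5or7-odd : ∀ n → 5or7 n → ∀ i → n ≢ i + i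
  5or7-odd n n≡5or7 i n≡i+i = even≢odd i (proj n≡5or7) (trans (sym (trans n≡i+i i+i≡2*i)) (n≡odd n≡5or7))
    where
    i+i≡2*i : i + i ≡ 2 * i
    i+i≡2*i = cong (i +_) (sym (+-identityʳ i))
    proj : 5or7 n → ℕ
    proj (inj₁ _) = 2 + n / 8 * 4
    proj (inj₂ _) = 3 + n / 8 * 4
    5+8q : ∀ q → 5 + q * 8 ≡ suc (2 * (2 + q * 4))
    5+8q = solve-∀
    7+8q : ∀ q → 7 + q * 8 ≡ suc (2 * (3 + q * 4))
    7+8q = solve-∀
    n≡odd : (h : 5or7 n) → n ≡ suc (2 * proj h)
    n≡odd (inj₁ n%8≡5) = trans (m≡m%n+[m/n]*n n 8) (trans (cong (_+ n / 8 * 8) n%8≡5) (5+8q (n / 8)))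
    n≡odd (inj₂ n%8≡7) = trans (m≡m%n+[m/n]*n n 8) (trans (cong (_+ n / 8 * 8) n%8≡7) (7+8q (n / 8)))

  5or7⇒2<n : ∀ n → 5or7 n → 2 < n
  5or7⇒2<n zero (inj₁ ())
  5or7⇒2<n zero (inj₂ ())
  5or7⇒2<n (suc zero) (inj₁ ())
  5or7⇒2<n (suc zero) (inj₂ ())
  5or7⇒2<n (suc (suc zero)) (inj₁ ())
  5or7⇒2<n (suc (suc zero)) (inj₂ ())
  5or7⇒2<n (suc (suc (suc n))) _ = s≤s (s≤s (s≤s z≤n))

  ∣-reduce : ∀ n .{{_ : NonZero n}} u → n ∣ u * u + 2 → n ∣ (u % n) * (u % n) + 2
  ∣-reduce n u n∣ = ∣m+n∣m⇒∣n {m = n * (q * (r + r + q * n))} (subst (n ∣_) eq n∣) (m∣m*n _)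
    where
    r = u % n
    q = u / n
    expand : ∀ r q n → (r + q * n) * (r + q * n) + 2 ≡ n * (q * (r + r + q * n)) + (r * r + 2)
    expand = solve-∀
    eq : u * u + 2 ≡ n * (q * (r + r + q * n)) + (r * r + 2)
    eq = trans (cong (λ v → v * v + 2) (m≡m%n+[m/n]*n u n)) (expand r q n)

  ∣-reflect : ∀ n r s → r + s ≡ n → n ∣ r * r + 2 → n ∣ s * s + 2
  ∣-reflect .(r + s) r s refl n∣ =
    ∣m+n∣m⇒∣n {m = n * n} (subst (n ∣_) (expand r s) (∣m∣n⇒∣m+n (m∣m*n (s + s)) n∣)) (m∣m*n n)
    where
    n = r + s
    expand : ∀ r s → (r + s) * (s + s) + (r * r + 2) ≡ (r + s) * (r + s) + (s * s + 2)
    expand = solve-∀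

  -- As n is odd, one of the residues r and n - r is odd. Oddness is what fixes the square, and so
  -- the cofactor, modulo 8.
  odd-root : ∀ n → 5or7 n → ∀ u → n ∣ u * u + 2 →
    ∃[ j ] (suc (j + j) < n × n ∣ suc (j + j) * suc (j + j) + 2)
  odd-root zero (inj₁ ())
  odd-root zero (inj₂ ())
  odd-root n@(suc _) n≡5or7 u n∣ with u % n | m%n<n u n | ∣-reduce n u n∣
  ... | r | r<n | n∣r with halve r
  ...   | j , inj₂ refl = j , r<n , n∣r
  -- The residue 0 has no reflection below n, but it would make n divide 2.
  ...   | zero , inj₁ refl = contradiction (∣⇒≤ n∣r) (<⇒≱ (5or7⇒2<n n n≡5or7))
  ...   | suc i , inj₁ refl with halve (n ∸ (suc i + suc i))
  ...     | j , inj₁ s≡j+j = contradiction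
              (trans (sym (m+[n∸m]≡n (<⇒≤ r<n))) (trans (cong (suc i + suc i +_) s≡j+j) (swap (suc i) j)))
              (5or7-odd n n≡5or7 (suc i + j))
    where
    swap : ∀ i j → i + i + (j + j) ≡ i + j + (i + j)
    swap = solve-∀
  ...     | j , inj₂ s≡ = j ,
              subst (_< n) s≡ (∸-monoʳ-< {n} z<s (<⇒≤ r<n)) ,
              subst (λ s → n ∣ s * s + 2) s≡
                (∣-reflect n (suc i + suc i) _ (m+[n∸m]≡n (<⇒≤ r<n)) n∣r)

  -- Since b² is 1 mod 8, a is 3b, and multiplication by 3 exchanges 5 and 7.
  *≡3-mod-8 : ∀ a b → a < 8 → a * b % 8 ≡ 3 → b ≡ 5 ⊎ b ≡ 7 → a ≡ 5 ⊎ a ≡ 7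
  *≡3-mod-8 5 _ _ ab≡3 _ = inj₁ refl
  *≡3-mod-8 7 _ _ ab≡3 _ = inj₂ refl
  *≡3-mod-8 0 _ _ () (inj₁ refl)
  *≡3-mod-8 0 _ _ () (inj₂ refl)
  *≡3-mod-8 1 _ _ () (inj₁ refl)
  *≡3-mod-8 1 _ _ () (inj₂ refl)
  *≡3-mod-8 2 _ _ () (inj₁ refl)
  *≡3-mod-8 2 _ _ () (inj₂ refl)
  *≡3-mod-8 3 _ _ () (inj₁ refl)
  *≡3-mod-8 3 _ _ () (inj₂ refl)
  *≡3-mod-8 4 _ _ () (inj₁ refl)
  *≡3-mod-8 4 _ _ () (inj₂ refl)
  *≡3-mod-8 6 _ _ () (inj₁ refl)
  *≡3-mod-8 6 _ _ () (inj₂ refl)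
  *≡3-mod-8 (suc (suc (suc (suc (suc (suc (suc (suc a)))))))) _ a<8 _ _ = contradiction a<8 (m+n≮m 8 a)

  -- Descent: u may be taken odd and below n, and then the cofactor (u² + 2) / n is
  -- again 5 or 7 mod 8 (as u² + 2 is 3 mod 8), is below n, and divides u² + 2.
  ∤u²+2 : ∀ n → 5or7 n → ∀ u → ¬ (n ∣ u * u + 2)
  ∤u²+2 = <-rec (λ n → 5or7 n → ∀ u → ¬ (n ∣ u * u + 2)) step
    where
    step : ∀ n → (∀ {m} → m < n → 5or7 m → ∀ u → ¬ (m ∣ u * u + 2)) → 5or7 n → ∀ u → ¬ (n ∣ u * u + 2)
    step n rec n≡5or7 u n∣ with odd-root n n≡5or7 u n∣
    ... | j , v<n , divides m v²+2≡mn =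
      rec m<n (*≡3-mod-8 (m % 8) (n % 8) (m%n<n m 8) mn%8≡3 n≡5or7) v (divides n (trans v²+2≡mn (*-comm m n)))
      where
      v = suc (j + j)
      mn%8≡3 : (m % 8) * (n % 8) % 8 ≡ 3
      mn%8≡3 = begin
        (m % 8) * (n % 8) % 8       ≡⟨ %-distribˡ-* m n 8 ⟨
        m * n % 8                   ≡⟨ cong (_% 8) v²+2≡mn ⟨
        (v * v + 2) % 8             ≡⟨ cong (λ s → (s + 2) % 8) (odd-square j) ⟩
        (8 * triangle j + 1 + 2) % 8 ≡⟨ cong (_% 8) (+-assoc (8 * triangle j) 1 2) ⟩
        (8 * triangle j + 3) % 8    ≡⟨ %-remove-+ˡ 3 (m∣m*n {8} (triangle j)) ⟩
        3                           ∎
        where open ≡-Reasoning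
      m<n : m < n
      m<n = *-cancelʳ-< n m n (begin-strict
        m * n           ≡⟨ v²+2≡mn ⟨
        v * v + 2       <⟨ +-monoʳ-< (v * v) (+-mono-≤ (+-mono-≤ {1} {v} (s≤s z≤n) (s≤s z≤n)) (≤-refl {1})) ⟩
        v * v + (v + v + 1)  ≡⟨ square v ⟩
        suc v * suc v   ≤⟨ *-mono-≤ v<n v<n ⟩
        n * n           ∎)
        where
        open ≤-Reasoning
        square : ∀ v → v * v + (v + v + 1) ≡ suc v * suc v
        square = solve-∀

  ¬∣⇒coprime : ∀ {p v} → Prime p → ¬ p ∣ v → Coprime p v
  ¬∣⇒coprime pr p∤v (d∣p , d∣v) with prime⇒irreducible pr d∣p
  ... | inj₁ d≡1 = d≡1
  ... | inj₂ refl = contradiction d∣v p∤v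

  -- If p does not divide v, Bézout gives w with wv congruent to 1 or -1, and multiplying by w²
  -- makes (uw)² + 2 divisible by p. The sign disappears because only (wv)² enters.
  ∣u²+2v²⇒∣v : ∀ {p} → Prime p → 5or7 p → ∀ u v → p ∣ u * u + 2 * (v * v) → p ∣ v
  ∣u²+2v²⇒∣v {p} pr p≡5or7 u v p∣ with p ∣? v
  ... | yes p∣v = p∣v
  ... | no p∤v with coprime-Bézout (¬∣⇒coprime pr p∤v)
  ...   | Bézout.-+ x w 1+xp≡wv = contradiction
            (∣m+n∣m⇒∣n {m = p * (4 * x + 2 * (x * (x * p)))} (subst (p ∣_) eq (∣n⇒∣m*n (w * w) p∣)) (m∣m*n _))
            (∤u²+2 p p≡5or7 (u * w))
    where
    expand : ∀ u w v → w * w * (u * u + 2 * (v * v)) ≡ u * w * (u * w) + 2 * (w * v * (w * v))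
    expand = solve-∀
    expand′ : ∀ s x p → s * s + 2 * ((1 + x * p) * (1 + x * p)) ≡ p * (4 * x + 2 * (x * (x * p))) + (s * s + 2)
    expand′ = solve-∀
    eq : w * w * (u * u + 2 * (v * v)) ≡ p * (4 * x + 2 * (x * (x * p))) + (u * w * (u * w) + 2)
    eq = trans (expand u w v) (trans (cong (λ s → u * w * (u * w) + 2 * (s * s)) (sym 1+xp≡wv)) (expand′ (u * w) x p))
  ...   | Bézout.+- x w 1+wv≡xp = contradiction
            (∣m+n∣m⇒∣n {m = p * (2 * (x * (x * p)))} (subst (p ∣_) eq
              (∣m∣n⇒∣m+n (m∣m*n (4 * x)) (∣n⇒∣m*n (w * w) p∣))) (m∣m*n _))
            (∤u²+2 p p≡5or7 (u * w))
    where
    expand : ∀ u w v x p → p * (4 * x) + w * w * (u * u + 2 * (v * v)) ≡ u * w * (u * w) + 4 * (x * p) + 2 * (w * v * (w * v))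
    expand = solve-∀
    expand′ : ∀ s t → s * s + 4 * (1 + t) + 2 * (t * t) ≡ 2 * ((1 + t) * (1 + t)) + (s * s + 2)
    expand′ = solve-∀
    expand″ : ∀ s x p → 2 * (x * p * (x * p)) + (s * s + 2) ≡ p * (2 * (x * (x * p))) + (s * s + 2)
    expand″ = solve-∀
    -- Here wv = xp - 1; the added 4xp cancels the cross term of 2 (xp - 1)², which keeps the
    -- identity in `ℕ`.
    eq : p * (4 * x) + w * w * (u * u + 2 * (v * v)) ≡ p * (2 * (x * (x * p))) + (u * w * (u * w) + 2)
    eq = begin
      p * (4 * x) + w * w * (u * u + 2 * (v * v))
        ≡⟨ expand u w v x p ⟩
      u * w * (u * w) + 4 * (x * p) + 2 * (w * v * (w * v))
        ≡⟨ cong (λ s → u * w * (u * w) + 4 * s + 2 * (w * v * (w * v))) (sym 1+wv≡xp) ⟩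
      u * w * (u * w) + 4 * (1 + w * v) + 2 * (w * v * (w * v))
        ≡⟨ expand′ (u * w) (w * v) ⟩
      2 * ((1 + w * v) * (1 + w * v)) + (u * w * (u * w) + 2)
        ≡⟨ cong (λ s → 2 * (s * s) + (u * w * (u * w) + 2)) 1+wv≡xp ⟩
      2 * (x * p * (x * p)) + (u * w * (u * w) + 2)
        ≡⟨ expand″ (u * w) x p ⟩
      p * (2 * (x * (x * p))) + (u * w * (u * w) + 2) ∎
      where open ≡-Reasoning

  ∣8N+3⇒∣2k+1 : ∀ {p} → Prime p → 5or7 p → ∀ j k → p ∣ 8 * (triangle j + 2 * triangle k) + 3 → p ∣ suc (k + k)
  ∣8N+3⇒∣2k+1 {p} pr p≡5or7 j k p∣ = ∣u²+2v²⇒∣v pr p≡5or7 (suc (j + j)) (suc (k + k)) (subst (p ∣_) eq p∣)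
    where
    expand : ∀ s t → 8 * (s + 2 * t) + 3 ≡ 8 * s + 1 + 2 * (8 * t + 1)
    expand = solve-∀
    eq : 8 * (triangle j + 2 * triangle k) + 3 ≡ suc (j + j) * suc (j + j) + 2 * (suc (k + k) * suc (k + k))
    eq = trans (expand (triangle j) (triangle k))
               (cong₂ (λ s t → s + 2 * t) (sym (odd-square j)) (sym (odd-square k)))

open MinusTwoIsNonresidue using (5or7; ∣8N+3⇒∣2k+1)

-- Recurrences for counting partitions and for the list of kinds.

open import Data.Nat.ListAction using (sum)
open import Defs
open import Data.Nat using (_+_; _*_)

sum-zero : ∀ {f} n → (∀ j → f j ≡ 0) → sum (applyUpTo f n) ≡ 0
sum-zero zero f≡0 = ≡.refl
sum-zero (suc n) f≡0 = ≡.cong₂ _+_ (f≡0 0) (sum-zero n (f≡0 ∘ suc))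

sum-extend : ∀ {f} m i → (∀ j → f (m + j) ≡ 0) → sum (applyUpTo f (m + i)) ≡ sum (applyUpTo f m)
sum-extend zero i f≡0 = sum-zero i f≡0
sum-extend {f} (suc m) i f≡0 = ≡.cong (f 0 +_) (sum-extend m i f≡0)

sum-cong : ∀ {f g} n → (∀ j → f j ≡ g j) → sum (applyUpTo f n) ≡ sum (applyUpTo g n)
sum-cong zero f≡g = ≡.refl
sum-cong (suc n) f≡g = ≡.cong₂ _+_ (f≡g 0) (sum-cong n (f≡g ∘ suc))

module _ (ks : List ℕ) where

  private
    term : ℕ → ℕ → ℕ → ℕ
    term k n j = if j * k ≤ᵇ n then countParts (n ∸ j * k) ks else 0

    term≡0 : ∀ k n j → n < j * k → term k n j ≡ 0
    term≡0 k n j n<jk rewrite dec-false (j * k ℕ.≤? n) (ℕ.<⇒≱ n<jk) = ≡.refl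

    term-shift : ∀ k n j → term k (k + n) (suc j) ≡ term k n j
    term-shift k n j with j * k ℕ.≤? n
    ... | yes jk≤n rewrite dec-true (k + j * k ℕ.≤? k + n) (ℕ.+-monoʳ-≤ k jk≤n)
                         | dec-true (j * k ℕ.≤? n) jk≤n = ≡.cong (λ i → countParts i ks) (ℕ.[m+n]∸[m+o]≡n∸o k n (j * k))
    ... | no jk≰n rewrite dec-false (k + j * k ℕ.≤? k + n) (jk≰n ∘ ℕ.+-cancelˡ-≤ k (j * k) n)
                        | dec-false (j * k ℕ.≤? n) jk≰n = ≡.refl

    countParts-∷ : ∀ k n → countParts n (k ∷ ks) ≡ countParts n ks + sum (applyUpTo (term k n ∘ suc) n)
    countParts-∷ k n = ≡.cong sum (List.map-upTo (term k n) (suc n))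

  countParts-< : ∀ k n → n < k → countParts n (k ∷ ks) ≡ countParts n ks
  countParts-< k n n<k = ≡.trans (countParts-∷ k n) (≡.trans
    (≡.cong (countParts n ks +_) (sum-zero n (λ j → term≡0 k n (suc j) (ℕ.<-≤-trans n<k (ℕ.m≤m+n k (j * k))))))
    (ℕ.+-identityʳ _))

  -- Either the kind k is absent or one copy of it can be removed. With `countParts-<` this says
  -- coefficientwise that 1 - q^k times the series of `k ∷ ks` is the series of `ks`.
  countParts-+ : ∀ k n → 0 < k → countParts (k + n) (k ∷ ks) ≡ countParts (k + n) ks + countParts n (k ∷ ks)
  countParts-+ k@(suc k-1) n _ = ≡.trans (countParts-∷ k (k + n)) (≡.cong (countParts (k + n) ks +_) (begin
    sum (applyUpTo (term k (k + n) ∘ suc) (k + n))  ≡⟨ sum-cong (k + n) (term-shift k n) ⟩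
    sum (applyUpTo (term k n) (k + n))              ≡⟨ ≡.cong (sum ∘ applyUpTo (term k n) ∘ suc) (ℕ.+-comm k-1 n) ⟩
    -- Multiplicities above n contribute nothing, because a kind of positive size used more than n
    -- times exceeds n.
    sum (applyUpTo (term k n) (suc n + k-1))        ≡⟨ sum-extend {term k n} (suc n) k-1 (λ j → term≡0 k n (suc n + j)
                                                        (ℕ.≤-trans (ℕ.m≤m+n (suc n) j) (ℕ.m≤m*n (suc n + j) k))) ⟩
    sum (applyUpTo (term k n) (suc n))              ≡⟨ ≡.cong sum (List.map-upTo (term k n) (suc n)) ⟨
    countParts n (k ∷ ks)                           ∎))
    where open ≡.≡-Reasoning

-- The local function kinds of colouredKinds, which has no name outside Defs.
kindsOfSize : ℕ → ℕ → List ℕ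
kindsOfSize c k = if k % 2 ≡ᵇ 0 then replicate c k else k ∷ []

concatMap-upTo-suc : ∀ (f : ℕ → List ℕ) n → concatMap f (upTo (suc n)) ≡ concatMap f (upTo n) ++ f n
concatMap-upTo-suc f n = ≡.trans (≡.cong (concatMap f) (≡.sym (List.upTo-∷ʳ n)))
  (≡.trans (List.concatMap-++ f (upTo n) (n ∷ [])) (≡.cong (concatMap f (upTo n) ++_) (List.++-identityʳ (f n))))

colouredKinds-suc : ∀ c n → colouredKinds c (suc n) ≡ colouredKinds c n ++ kindsOfSize c (suc n)
-- The underscore is the local function of `colouredKinds`; its instances at n and `suc n` and the
-- function `kindsOfSize` unfold to the same conditional.
colouredKinds-suc c n = concatMap-upTo-suc _ n

colouredKinds-positive : ∀ c n → All (0 <_) (colouredKinds c n)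
colouredKinds-positive c zero = []
colouredKinds-positive c (suc n) rewrite colouredKinds-suc c n = All.++⁺ (colouredKinds-positive c n) positive
  where
  positive : All (0 <_) (kindsOfSize c (suc n))
  positive with suc n % 2 ≡ᵇ 0
  ... | true = All.replicate⁺ c (s≤s z≤n)
  ... | false = s≤s z≤n ∷ []

[1+L+L]%2≡1 : ∀ L → suc (L + L) % 2 ≡ 1
[1+L+L]%2≡1 L = ≡.trans (≡.cong (_% 2) (expand L)) ([m+kn]%n≡m%n 1 L 2)
  where
  expand : ∀ L → suc (L + L) ≡ 1 + L * 2
  expand = solve-∀

[2+L+L]%2≡0 : ∀ L → suc (suc (L + L)) % 2 ≡ 0
[2+L+L]%2≡0 L = ≡.trans (≡.cong (_% 2) (expand L)) (m*n%n≡0 (suc L) 2)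
  where
  expand : ∀ L → suc (suc (L + L)) ≡ suc L * 2
  expand = solve-∀

-- Sizes are added two at a time, so that each step brings exactly one new factor of f₂.
colouredKinds-2+ : ∀ c L → colouredKinds c (suc L + suc L) ≡
  (colouredKinds c (L + L) ++ suc (L + L) ∷ []) ++ replicate c (suc (suc (L + L)))
colouredKinds-2+ c L = begin
  colouredKinds c (suc (L + suc L))
    ≡⟨ ≡.cong (colouredKinds c ∘ suc) (ℕ.+-suc L L) ⟩
  colouredKinds c (suc (suc (L + L)))
    ≡⟨ colouredKinds-suc c (suc (L + L)) ⟩
  colouredKinds c (suc (L + L)) ++ kindsOfSize c (suc (suc (L + L)))
    ≡⟨ ≡.cong (_++ kindsOfSize c (suc (suc (L + L)))) (colouredKinds-suc c (L + L)) ⟩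
  (colouredKinds c (L + L) ++ kindsOfSize c (suc (L + L))) ++ kindsOfSize c (suc (suc (L + L)))
    ≡⟨ ≡.cong₂ (λ ks ls → (colouredKinds c (L + L) ++ ks) ++ ls)
         (≡.cong (λ i → if i ≡ᵇ 0 then replicate c (suc (L + L)) else suc (L + L) ∷ []) ([1+L+L]%2≡1 L))
         (≡.cong (λ i → if i ≡ᵇ 0 then replicate c (suc (suc (L + L))) else suc (suc (L + L)) ∷ []) ([2+L+L]%2≡0 L)) ⟩
  (colouredKinds c (L + L) ++ suc (L + L) ∷ []) ++ replicate c (suc (suc (L + L))) ∎
  where open ≡.≡-Reasoning

-- The denominator of the generating function as a product over kinds.

module KindsProduct {c ℓ} (R : CommutativeRing c ℓ) (x : CommutativeRing.Carrier R) where
  open CommutativeRing R hiding (zero; _+_; _*_)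
  open CommutativeRing R using () renaming (_*_ to _·_)
  open IntegerCoefficients R
  open FiniteTripleProduct R
  open PowersAndMultiples R
  open Exp commutativeSemiring
  open SetoidReasoning setoid

  kindsProduct : List ℕ → Carrier
  kindsProduct [] = 1#
  kindsProduct (k ∷ ks) = (1# - x ^ k) · kindsProduct ks

  kindsProduct-++ : ∀ ks ls → kindsProduct (ks ++ ls) ≈ kindsProduct ks · kindsProduct ls
  kindsProduct-++ [] ls = sym (*-identityˡ _)
  kindsProduct-++ (k ∷ ks) ls = trans (*-congˡ (kindsProduct-++ ks ls)) (sym (*-assoc _ _ _))

  kindsProduct-replicate : ∀ n k → kindsProduct (replicate n k) ≈ (1# - x ^ k) ^ n
  kindsProduct-replicate zero k = refl
  kindsProduct-replicate (suc n) k = *-congˡ (kindsProduct-replicate n k)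

  -- One colour of each even size completes f₁ together with the odd sizes; the other c - 1 = n
  -- colours give f₂^n.
  kindsProduct-colouredKinds : ∀ n L →
    kindsProduct (colouredKinds (suc n) (L + L)) ≈ poch x (L + L) · poch (x · x) L ^ n
  kindsProduct-colouredKinds n zero = sym (trans (*-identityˡ _) (1^n≈1 n))
  kindsProduct-colouredKinds n (suc L) = begin
    kindsProduct (colouredKinds (suc n) (suc L + suc L))
      ≡⟨ ≡.cong kindsProduct (colouredKinds-2+ (suc n) L) ⟩
    kindsProduct ((ks ++ k ∷ []) ++ replicate (suc n) (suc k))
      ≈⟨ trans (kindsProduct-++ (ks ++ k ∷ []) (replicate (suc n) (suc k)))
               (*-cong (kindsProduct-++ ks (k ∷ [])) (kindsProduct-replicate (suc n) (suc k))) ⟩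
    kindsProduct ks · (u · 1#) · (w · w ^ n)
      ≈⟨ *-congʳ (*-congʳ (kindsProduct-colouredKinds n L)) ⟩
    poch x (L + L) · poch (x · x) L ^ n · (u · 1#) · (w · w ^ n)
      ≈⟨ solve 5 (λ a b c d e → a :* b :* (c :* :1) :* (d :* e) := a :* c :* d :* (b :* e)) refl _ _ _ _ _ ⟩
    poch x (L + L) · u · w · (poch (x · x) L ^ n · w ^ n)
      ≈⟨ *-congˡ (^-distrib-* _ _ n) ⟨
    poch x (L + L) · u · w · (poch (x · x) L · w) ^ n
      ≈⟨ *-congˡ (^-congˡ n (*-congˡ (+-congˡ (-‿cong x^2[L+1])))) ⟩
    poch x (L + L) · u · w · (poch (x · x) L · (1# - (x · x) ^ suc L)) ^ n
      ≡⟨ ≡.cong (λ i → poch x (suc i) · poch (x · x) (suc L) ^ n) (ℕ.+-suc L L) ⟨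
    poch x (suc L + suc L) · poch (x · x) (suc L) ^ n ∎
    where
    ks = colouredKinds (suc n) (L + L)
    k = suc (L + L)
    u = 1# - x ^ k
    w = 1# - x ^ suc k
    x^2[L+1] : x ^ suc (suc (L + L)) ≈ (x · x) ^ suc L
    x^2[L+1] = trans (reflexive (≡.cong (λ i → x ^ suc i) (≡.sym (ℕ.+-suc L L))))
      (trans (^-homo-* x (suc L) (suc L)) (sym (^-distrib-* x x (suc L))))

  -- Sizes above m contribute factors 1, so the list for m can be lengthened to the even length at
  -- which the product factors.
  kindsProduct-stable : ∀ c m → (∀ {i} → m < i → x ^ i ≈ 0#) → ∀ j →
    kindsProduct (colouredKinds c (m + j)) ≈ kindsProduct (colouredKinds c m)
  kindsProduct-stable c m x^i≈0 zero rewrite ℕ.+-identityʳ m = refl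
  kindsProduct-stable c m x^i≈0 (suc j) rewrite ℕ.+-suc m j = begin
    kindsProduct (colouredKinds c k)
      ≡⟨ ≡.cong kindsProduct (colouredKinds-suc c (m + j)) ⟩
    kindsProduct (colouredKinds c (m + j) ++ kindsOfSize c k)
      ≈⟨ kindsProduct-++ (colouredKinds c (m + j)) (kindsOfSize c k) ⟩
    kindsProduct (colouredKinds c (m + j)) · kindsProduct (kindsOfSize c k)
      ≈⟨ *-cong (kindsProduct-stable c m x^i≈0 j) ofSize≈1 ⟩
    kindsProduct (colouredKinds c m) · 1#
      ≈⟨ *-identityʳ _ ⟩
    kindsProduct (colouredKinds c m) ∎
    where
    k = suc (m + j)
    cons≈ : ∀ ls → kindsProduct (k ∷ ls) ≈ kindsProduct ls
    cons≈ ls = trans (*-congʳ (+-congˡ (-‿cong (x^i≈0 (s≤s (ℕ.m≤m+n m j))))))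
      (solve 1 (λ p → (:1 :- :0) :* p := p) refl _)
    replicate≈ : ∀ n → kindsProduct (replicate n k) ≈ 1#
    replicate≈ zero = refl
    replicate≈ (suc n) = trans (cons≈ (replicate n k)) (replicate≈ n)
    ofSize≈1 : kindsProduct (kindsOfSize c k) ≈ 1#
    ofSize≈1 with k % 2 ≡ᵇ 0
    ... | true = replicate≈ c
    ... | false = cons≈ []

-- Generating functions in characteristic p and their vanishing coefficients.

module Coefficients {c ℓ} (K : CommutativeRing c ℓ)
  {r : ℕ} (pr : Prime (5 + r)) (p≡5or7 : 5or7 (5 + r))
  (p×1≈0 : PowersAndMultiples.CharacteristicDivides K (5 + r)) (N : ℕ) where

  open CommutativeRing K using (_≈_; 0#; 1#)
  open Mult (CommutativeRing.semiring K) using (_×_)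
  open PowerSeries K
  private
    p : ℕ
    p = 5 + r
    module K where
      open CommutativeRing K public
      open Mult semiring public
      open RingProperties ring public using (-0#≈0#)
    -- The least truncation order that still shows the coefficient at N.
    M = suc N
    R = truncated M
  open CommutativeRing R hiding (zero; _+_; _*_; _≈_; 0#; 1#)
  open CommutativeRing R using () renaming (_≈_ to _≈ᴿ_; 1# to 1ᴿ; 0# to 0ᴿ)
  open Exp commutativeSemiring
  open Mult semiring using () renaming (_×_ to _×ᴿ_)
  open IntegerCoefficients R
  open FiniteTripleProduct R using (poch)
  open Nilpotent R
  open KindsProduct R X
  open SetoidReasoning setoid

  generatingFunction : List ℕ → Series
  generatingFunction ks n = countParts n ks × 1#

  generatingFunction-∷ : ∀ k ks → 0 < k →
    generatingFunction (k ∷ ks) ≋ generatingFunction ks ⊕ X ^ k ✶ generatingFunction (k ∷ ks)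
  generatingFunction-∷ k ks 0<k n with n ℕ.<? k
  ... | yes n<k = K.trans (K.×-congˡ (countParts-< ks k n n<k))
        (K.sym (K.trans (K.+-congˡ (X^k-< M k _ n<k)) (K.+-identityʳ _)))
  ... | no n≮k with ℕ.m+[n∸m]≡n (ℕ.≮⇒≥ n≮k)
  ...   | k+i≡n rewrite ≡.sym k+i≡n = K.trans (K.×-congˡ (countParts-+ ks k i 0<k))
        (K.trans (K.×-homo-+ 1# (countParts (k + i) ks) (countParts i (k ∷ ks)))
          (K.+-congˡ (K.sym (X^k-+ M k i (generatingFunction (k ∷ ks))))))
    where i = n ∸ k

  generatingFunction-inverse : ∀ {ks} → All (0 <_) ks → generatingFunction ks ✶ kindsProduct ks ≈ᴿ 1ᴿ
  generatingFunction-inverse [] = trans (*-identityʳ _)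
    λ { zero _ → K.+-identityʳ 1# ; (suc n) _ → K.refl }
  generatingFunction-inverse {k ∷ ks} (0<k ∷ ks>0) = begin
    g ✶ ((1ᴿ - X ^ k) ✶ P)
      ≈⟨ solve 3 (λ g q P → g :* ((:1 :- q) :* P) := (g :- q :* g) :* P) refl g (X ^ k) P ⟩
    (g - X ^ k ✶ g) ✶ P
      ≈⟨ *-congʳ (+-congʳ (λ n _ → generatingFunction-∷ k ks 0<k n)) ⟩
    (generatingFunction ks ⊕ X ^ k ✶ g - X ^ k ✶ g) ✶ P
      ≈⟨ *-congʳ (solve 2 (λ a b → a :+ b :- b := a) refl (generatingFunction ks) (X ^ k ✶ g)) ⟩
    generatingFunction ks ✶ P
      ≈⟨ generatingFunction-inverse ks>0 ⟩
    1ᴿ ∎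
    where
    g = generatingFunction (k ∷ ks)
    P = kindsProduct ks

  p×𝟙≈𝟘 : p ×ᴿ 1ᴿ ≈ᴿ 0ᴿ
  p×𝟙≈𝟘 n _ = K.trans (×𝟙-coeff M p n) (𝟙-coeff n)
    where
    𝟙-coeff : ∀ n → p × 𝟙 n ≈ 0#
    𝟙-coeff zero = p×1≈0
    𝟙-coeff (suc n) = PowersAndMultiples.n×0≈0 K p

  open CubicPartitionSeries R {r} pr p×𝟙≈𝟘
  open AtNilpotent {X} {M} (X^M≈𝟘 M)

  -- The concrete choice of the abstract group S: the condition on n is unchanged by shifting n by
  -- p, which gives closure under X^p.
  Vanishing : Series → Set ℓ
  Vanishing f = ∀ n → n < M → p ∣ 8 * n + 3 → f n ≈ 0#

  vanishing-additive : IsAdditive Vanishing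
  vanishing-additive = record
    { resp = λ f≈g Sf n n<M p∣ → K.trans (K.sym (f≈g n n<M)) (Sf n n<M p∣)
    ; 0-closed = λ _ _ _ → K.refl
    ; +-closed = λ Sf Sg n n<M p∣ → K.trans (K.+-cong (Sf n n<M p∣) (Sg n n<M p∣)) (K.+-identityʳ 0#)
    ; -‿closed = λ Sf n n<M p∣ → K.trans (K.-‿cong (Sf n n<M p∣)) K.-0#≈0#
    }

  X^p-closed : ∀ {f} → Vanishing f → Vanishing (f ✶ X ^ p)
  X^p-closed {f} Sf n n<M p∣ with n ℕ.<? p
  ... | yes n<p = K.trans (✶-comm f (X ^ p) n) (X^k-< M p f n<p)
  ... | no n≮p with ℕ.m+[n∸m]≡n (ℕ.≮⇒≥ n≮p)
  ...   | p+i≡n = ≡.subst (λ n → (f ✶ X ^ p) n ≈ 0#) p+i≡n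
          (K.trans (✶-comm f (X ^ p) (p + i)) (K.trans (X^k-+ M p i f)
            (Sf i (ℕ.≤-<-trans (ℕ.m∸n≤m n p) n<M)
              (∣m+n∣m⇒∣n {m = p * 8}
                (≡.subst (p ∣_) (≡.trans (≡.cong (λ n → 8 * n + 3) (≡.sym p+i≡n)) (expand p i)) p∣)
                (m∣m*n 8)))))
    where
    i = n ∸ p
    expand : ∀ p i → 8 * (p + i) + 3 ≡ p * 8 + (8 * i + 3)
    expand = solve-∀

  -- The only nonzero coefficient sits at triangle j + 2 triangle k, and at an index satisfying the
  -- condition `∣8N+3⇒∣2k+1` would force p to divide 2k + 1.
  monomial-vanishing : ∀ j k → ¬ p ∣ suc (k + k) → Vanishing (X ^ triangle j ✶ (X ✶ X) ^ triangle k)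
  monomial-vanishing j k p∤2k+1 n n<M p∣ = K.trans (monomial≈ n n<M)
    (X^k-≢ M (triangle j + 2 * triangle k) n λ { ≡.refl → p∤2k+1 (∣8N+3⇒∣2k+1 pr p≡5or7 j k p∣) })
    where
    monomial≈ : X ^ triangle j ✶ (X ✶ X) ^ triangle k ≈ᴿ X ^ (triangle j + 2 * triangle k)
    monomial≈ = sym (trans (^-homo-* X (triangle j) (2 * triangle k))
      (*-congˡ (trans (sym (^-assocʳ X 2 (triangle k)))
        (^-congˡ (triangle k) (*-congˡ (*-identityʳ X))))))

  private
    -- The list of kinds in `a` grows with its argument, so it is frozen at N; the coefficient of
    -- `G` at N is then `a (suc r) N` times 1.
    G : Series
    G = generatingFunction (colouredKinds (suc r) N)

    G-inverse : G ✶ (f₁ ✶ f₂ ^ r) ≈ᴿ 1ᴿ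
    G-inverse = begin
      G ✶ (f₁ ✶ f₂ ^ r)
        -- Pairing sizes gives twice as many factors in f₁ as in f₂; since X^M = 0, the products to
        -- M and to 2M agree.
        ≈⟨ *-congˡ (*-congʳ (poch-stable {X} {M} (X^M≈𝟘 M) (ℕ.m≤m+n M M))) ⟨
      G ✶ (poch X (M + M) ✶ f₂ ^ r)
        ≈⟨ *-congˡ (kindsProduct-colouredKinds r M) ⟨
      G ✶ kindsProduct (colouredKinds (suc r) (M + M))
        ≡⟨ ≡.cong (λ i → G ✶ kindsProduct (colouredKinds (suc r) i)) (≡.sym (ℕ.+-suc N M)) ⟩
      G ✶ kindsProduct (colouredKinds (suc r) (N + suc M))
        ≈⟨ *-congˡ (kindsProduct-stable (suc r) N (x^j≈0 {X} {M} (X^M≈𝟘 M)) (suc M)) ⟩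
      G ✶ kindsProduct (colouredKinds (suc r) N)
        ≈⟨ generatingFunction-inverse (colouredKinds-positive (suc r) N) ⟩
      1ᴿ ∎

  a≈0 : p ∣ 8 * N + 3 → a (suc r) N × 1# ≈ 0#
  a≈0 p∣8N+3 = inverse∈S vanishing-additive X^p-closed monomial-vanishing G-inverse N ℕ.≤-refl p∣8N+3

-- Reading the vanishing in the integers modulo p.

p∣a : ∀ r → Prime (5 + r) → 5or7 (5 + r) → ∀ N → 5 + r ∣ 8 * N + 3 → 5 + r ∣ a (suc r) N
p∣a r pr p≡5or7 N p∣8N+3 = m%n≡0⇒n∣m (a (suc r) N) p
  (≡.subst (λ i → i % p ≡ 0) (×1≡ (a (suc r) N)) (Coefficients.a≈0 (ℕ-mod p) {r} pr p≡5or7 p×1≈0 N p∣8N+3))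
  where
  p = 5 + r
  open Mult (CommutativeRing.semiring (ℕ-mod p)) using (_×_)
  ×1≡ : ∀ i → i × 1 ≡ i
  ×1≡ zero = ≡.refl
  ×1≡ (suc i) = ≡.cong suc (×1≡ i)
  p×1≈0 : (p × 1) % p ≡ 0
  p×1≈0 = ≡.trans (≡.cong (_% p) (×1≡ p)) (n%n≡0 p)

theorem3p1 : (p : ℕ) → Prime p → (p % 8 ≡ 5 ⊎ p % 8 ≡ 7) →
    (l : ℕ) → l ≤ p ∸ 1 → p ∣ 8 * l + 3 →
    (n : ℕ) → p ∣ a (p ∸ 4) (p * n + l)
theorem3p1 0 _ (inj₁ ())
theorem3p1 0 _ (inj₂ ())
theorem3p1 1 _ (inj₁ ())
theorem3p1 1 _ (inj₂ ())
theorem3p1 2 _ (inj₁ ())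
theorem3p1 2 _ (inj₂ ())
theorem3p1 3 _ (inj₁ ())
theorem3p1 3 _ (inj₂ ())
theorem3p1 4 _ (inj₁ ())
theorem3p1 4 _ (inj₂ ())
-- The residue condition has excluded p below 5, and with p = 5 + r the term `p ∸ 4` computes to
-- `suc r`.
theorem3p1 p@(suc (suc (suc (suc (suc r))))) pr p≡5or7 l _ p∣8l+3 n =
  p∣a r pr p≡5or7 (p * n + l)
    (≡.subst (p ∣_) (expand p n l) (∣m∣n⇒∣m+n (m∣m*n (8 * n)) p∣8l+3))
  where
  expand : ∀ p n l → p * (8 * n) + (8 * l + 3) ≡ 8 * (p * n + l) + 3
  expand = solve-∀
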